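{- (1) $\mathrm{P\text{ - }Sel}\wedge\mathrm{P\text{ - }Sel}\subseteq\mathrm{P\text{ - }mc}(3)$, yet $\mathrm{P\text{ - }Sel}\wedge\mathrm{P\text{ - }Sel}\not\subseteq\mathrm{P\text{ - }mc}(2)$. (2) $\mathrm{P\text{ - }Sel}\vee\mathrm{P\text{ - }Sel}\subseteq\mathrm{P\text{ - }mc}(3)$, yet $\mathrm{P\text{ - }Sel}\vee\mathrm{P\text{ - }Sel}\not\subseteq\mathrm{P\text{ - }mc}(2)$. (3) $\mathrm{P\text{ - }Sel}\,\mathrm{XOR}\,\mathrm{P\text{ - }Sel}\not\subseteq\mathrm{P\text{ - }mc}(3)$ and $\mathrm{P\text{ - }Sel}\,\mathrm{NXOR}\,\mathrm{P\text{ - }Sel}\not\subseteq\mathrm{P\text{ - }mc}(3)$.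
   Context: Sets are languages over $\Sigma=\{0,1\}$; FP is the class of polynomial-time computable functions; $\chi_A$ is the characteristic function of $A$; $\overline{A}=\Sigma^*-A$. A set $L$ is P-selective ($L\in\mathrm{P\text{ - }Sel}$) if there is an FP function $f$ such that for all $x,y$, $f(x,y)\in\{x,y\}$ and if $x\in L$ or $y\in L$ then $f(x,y)\in L$. For classes $\mathcal{C},\mathcal{D}$: $\mathcal{C}\wedge\mathcal{D}=\{A\cap B:A\in\mathcal{C},B\in\mathcal{D}\}$, $\mathcal{C}\vee\mathcal{D}=\{A\cup B\}$, $\mathcal{C}\,\mathrm{XOR}\,\mathcal{D}=\{(A\cap\overline{B})\cup(\overline{A}\cap B)\}$, $\mathcal{C}\,\mathrm{NXOR}\,\mathcal{D}=\{(A\cap B)\cup(\overline{A}\cap\overline{B})\}$ (with $A\in\mathcal{C}$, $B\in\mathcal{D}$). For a positive integer $k$, $\mathrm{P\text{ - }mc}(k)$ is the class of sets $A$ having a polynomial-time computable $f$ such that for all strings $z_1,\dots,z_m$ with $m\geq k$, $f(z_1,\dots,z_m)\in\{0,1\}^m$ and $(\chi_A(z_1),\dots,\chi_A(z_m))\neq f(z_1,\dots,z_m)$. -}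

module Defs where

open import Data.Bool using (Bool; true; false)
open import Data.Nat using (ℕ; zero; suc; _+_; _*_; _^_; _≤_)
open import Data.Fin using (Fin)
open import Data.List using (List; []; _∷_; _++_; length)
open import Data.Maybe using (Maybe; just; nothing)
import Data.Maybe as Maybe
open import Data.Product using (Σ; _×_; _,_)
open import Data.Sum using (_⊎_)
open import Data.Unit using (⊤)
open import Data.Empty using (⊥)
open import Relation.Nullary using (¬_)
open import Relation.Binary.PropositionalEquality using (_≡_)

Str : Set
Str = List Bool

Lang : Set₁
Lang = Str → Set

_∩_ : Lang → Lang → Lang
(A ∩ B) x = A x × B x

_∪_ : Lang → Lang → Lang
(A ∪ B) x = A x ⊎ B x

_XOR_ : Lang → Lang → Lang
(A XOR B) x = (A x × ¬ B x) ⊎ (¬ A x × B x)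

_NXOR_ : Lang → Lang → Lang
(A NXOR B) x = (A x × B x) ⊎ (¬ A x × ¬ B x)

-- Single-tape deterministic Turing machines over tape alphabet
-- {blank, 0, 1} (blank = nothing).

Sym : Set
Sym = Maybe Bool

data Move : Set where
  L R S : Move

record TM : Set where
  field
    nQ    : ℕ
    start : Fin nQ
    -- nothing = halt
    δ     : Fin nQ → Sym → Maybe (Fin nQ × Sym × Move)

record Config (n : ℕ) : Set where
  constructor cfg
  field
    state : Fin n
    left  : List Sym   -- cells left of the head, nearest first
    head  : Sym
    right : List Sym   -- cells right of the head, nearest first

move : Move → List Sym → Sym → List Sym → (List Sym × Sym × List Sym)
move L []      h r = ([] , h , r)
move L (a ∷ l) h r = (l , a , h ∷ r)
move R l h []      = (h ∷ l , nothing , [])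
move R l h (a ∷ r) = (h ∷ l , a , r)
move S l h r       = (l , h , r)

step : (M : TM) → Config (TM.nQ M) → Maybe (Config (TM.nQ M))
step M (cfg q l h r) with TM.δ M q h
... | nothing = nothing
... | just (q' , s , m) with move m l s r
...   | (l' , h' , r') = just (cfg q' l' h' r')

exec : (M : TM) → ℕ → Config (TM.nQ M) → Maybe (Config (TM.nQ M))
exec M n c with step M c
exec M n       c | nothing = just c
exec M zero    c | just _  = nothing
exec M (suc n) c | just c' = exec M n c'

inputTape : Str → Sym × List Sym
inputTape []      = (nothing , [])
inputTape (b ∷ w) = (just b , Data.List.map just w)
  where import Data.List

initial : (M : TM) → Str → Config (TM.nQ M)
initial M w with inputTape w
... | (h , r) = cfg (TM.start M) [] h r

readOut : List Sym → Str
readOut (just b ∷ r) = b ∷ readOut r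
readOut _            = []

output : {n : ℕ} → Config n → Str
output (cfg _ _ h r) = readOut (h ∷ r)

PolyTimeOn : {X : Set} → (X → Str) → (X → Str) → Set
PolyTimeOn {X} enc g =
  Σ TM λ M → Σ ℕ λ c → Σ ℕ λ k → (x : X) →
    Maybe.map output (exec M (c * (length (enc x) ^ k) + c) (initial M (enc x)))
      ≡ just (g x)

encBits : Str → Str
encBits []          = []
encBits (false ∷ w) = false ∷ false ∷ encBits w
encBits (true ∷ w)  = false ∷ true ∷ encBits w

encodeList : List Str → Str
encodeList []       = []
encodeList (z ∷ zs) = encBits z ++ (true ∷ true ∷ []) ++ encodeList zs

encodePair : Str × Str → Str
encodePair (x , y) = encodeList (x ∷ y ∷ [])

FP₂ : (Str → Str → Str) → Set
FP₂ f = PolyTimeOn encodePair (λ { (x , y) → f x y })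

FPList : (List Str → Str) → Set
FPList f = PolyTimeOn encodeList f

PSel : Lang → Set
PSel A = Σ (Str → Str → Str) λ f → FP₂ f ×
  ((x y : Str) → (f x y ≡ x ⊎ f x y ≡ y) × (A x ⊎ A y → A (f x y)))

Agrees : Lang → Str → Bool → Set
Agrees A z true  = A z
Agrees A z false = ¬ A z

IsCharVec : Lang → List Str → List Bool → Set
IsCharVec A []       []       = ⊤
IsCharVec A (z ∷ zs) (b ∷ bs) = Agrees A z b × IsCharVec A zs bs
IsCharVec A _        _        = ⊥

Pmc : ℕ → Lang → Set
Pmc k A = Σ (List Str → List Bool) λ f → FPList f ×
  ((zs : List Str) → k ≤ length zs →
     (length (f zs) ≡ length zs) × ¬ IsCharVec A zs (f zs))

_⊙PSel⊆Pmc_ : (Lang → Lang → Lang) → ℕ → Set₁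
op ⊙PSel⊆Pmc k = (A B : Lang) → PSel A → PSel B → Pmc k (op A B)

_⊙PSel⊈Pmc_ : (Lang → Lang → Lang) → ℕ → Set₁
op ⊙PSel⊈Pmc k =
  Σ Lang λ A → Σ Lang λ B → PSel A × PSel B × ¬ Pmc k (op A B)

{-# OPTIONS --safe #-}
module Submission where

-- Inclusions.  Draw an edge x → y for A when the selector of A certifies A x → A y, and
-- likewise for B.  In a tournament on three strings at most one vertex has no incoming edge,
-- so some y has an incoming A-edge from x and an incoming B-edge from x′; then A ∩ B cannot
-- contain the other strings but not y.  Dually, for A ∪ B take y with outgoing edges.
--
-- Non-inclusions.  Let A and B be initial segments of the lexicographic order on the even,
-- respectively the odd, bits of a string, with cuts r and s; the selectors return the minimum.
-- Stage e extends both cuts by two bits.  Among the extensions there are test strings that the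
-- two orders arrange differently, so every vector of answers on them is the characteristic
-- vector for some choice of the two bits; choose the one which the e-th clocked machine outputs.
--
-- Machines.  Programs with finite control over a state space are translated from stacks to a
-- tape of letters (home s₁ sep s₂ sep … sₖ) and from letters to pairs of cells, each time with
-- at most quadratic slowdown, and then flattened to a transition table.

open import Defs
open import Data.Bool using (Bool; true; false; _∧_; _∨_; not; _xor_; if_then_else_)
open import Data.Empty using (⊥-elim)
open import Data.Fin using (Fin; zero; suc; toℕ; fromℕ<; inject₁; _↑ˡ_; _↑ʳ_; splitAt)
open import Data.Fin.Patterns
import Data.Fin.Properties as Fin
open import Data.List using (List; []; _∷_; _++_; map; length; _ʳ++_; reverse; foldl; foldr; replicate)
open import Data.List.Properties using (ʳ++-defn; ++-ʳ++; ʳ++-ʳ++; length-ʳ++; map-ʳ++; length-map; length-++; length-replicate; ++-assoc; ++-identityʳ; map-++; map-∘; map-cong; reverse-foldl)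
open import Data.Maybe using (Maybe; just; nothing)
import Data.Maybe as Maybe
open import Data.Nat using (ℕ; zero; suc; _+_; _*_; _^_; _≤_; z≤n; s≤s)
open import Data.Nat.Properties
open import Data.Nat.Solver using (module +-*-Solver)
open import Data.Product using (Σ; _×_; _,_; proj₁; proj₂)
open import Data.Sum using (_⊎_; inj₁; inj₂; [_,_]′)
open import Data.Unit using (⊤; tt)
open import Data.Vec using (Vec; []; _∷_; _∷ʳ_; lookup; _[_]≔_; tabulate)
import Data.Vec as Vec
open import Data.Vec.Properties using (lookup∘tabulate; lookup∘update; []≔-idempotent; []≔-lookup)
open import Function using (_∘_; id; flip)
open import Relation.Binary.PropositionalEquality
open import Relation.Nullary using (¬_; yes; no; does)

-- Each of the two selectors disqualifies at most one vertex, so among three strings one is left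
-- with both edges. Among two strings the selectors may disqualify both; the tests `t₁` and `t₂`,
-- ordered oppositely by the two cuts, realise this.
--
-- The selectors of the cuts never consult the cuts themselves, so `r` and `s` can be fixed by
-- diagonalisation without harming P-selectivity. Interleaving the bits makes the two orders
-- independent. The tests of stage `e` begin with all blocks chosen before; both cuts agree with
-- that prefix, and the tests end with block `e`, so their membership depends on the choice of stage
-- `e` alone and no other stage can disturb it.
--
-- In the inclusions the selectors are known only through time-bounded machines on encoded pairs.
-- The function that avoids the characteristic vector therefore has to contain a simulator, which
-- builds these encodings, runs both machines, compares their outputs with the input strings and
-- cleans up after each run. Writing that as a transition table would be hopeless, hence programs on
-- stacks and a chain of translations whose time bounds compose.

-- Finite types as retracts of `Fin n`

record Finite (X : Set) : Set where
  field
    card    : ℕ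
    enc     : X → Fin card
    dec     : Fin card → X
    dec-enc : ∀ x → dec (enc x) ≡ x

open Finite

retract-finite : {X Y : Set} (f : X → Y) (g : Y → X) → (∀ x → g (f x) ≡ x) → Finite Y → Finite X
retract-finite f g g-f Y = record
  { card = card Y ; enc = enc Y ∘ f ; dec = g ∘ dec Y
  ; dec-enc = λ x → trans (cong g (dec-enc Y (f x))) (g-f x) }

instance
  ⊤-finite : Finite ⊤
  ⊤-finite = record { card = 1 ; enc = λ _ → zero ; dec = λ _ → tt ; dec-enc = λ _ → refl }

  Fin-finite : ∀ {n} → Finite (Fin n)
  Fin-finite {n} = record { card = n ; enc = id ; dec = id ; dec-enc = λ _ → refl }

  ⊎-finite : {X Y : Set} {{_ : Finite X}} {{_ : Finite Y}} → Finite (X ⊎ Y)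
  ⊎-finite {X} {Y} {{fX}} {{fY}} = record
    { card = card fX + card fY
    ; enc = [ (λ x → enc fX x ↑ˡ card fY) , (λ y → card fX ↑ʳ enc fY y) ]′
    ; dec = λ i → [ inj₁ ∘ dec fX , inj₂ ∘ dec fY ]′ (splitAt (card fX) i)
    ; dec-enc = λ where
        (inj₁ x) → trans (cong [ _ , _ ]′ (Fin.splitAt-↑ˡ (card fX) (enc fX x) (card fY)))
                         (cong inj₁ (dec-enc fX x))
        (inj₂ y) → trans (cong [ _ , _ ]′ (Fin.splitAt-↑ʳ (card fX) (card fY) (enc fY y)))
                         (cong inj₂ (dec-enc fY y)) }

Fin-Σ-finite : ∀ {n} {P : Fin n → Set} → (∀ i → Finite (P i)) → Finite (Σ (Fin n) P)
Fin-Σ-finite {zero} _ = record { card = 0 ; enc = λ { (() , _) } ; dec = λ () ; dec-enc = λ { (() , _) } }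
Fin-Σ-finite {suc n} {P} fP = retract-finite to from
  (λ { (zero , _) → refl ; (suc _ , _) → refl })
  (⊎-finite {{fP zero}} {{Fin-Σ-finite (fP ∘ suc)}})
  where
  to : Σ (Fin (suc n)) P → P zero ⊎ Σ (Fin n) (P ∘ suc)
  to (zero , p) = inj₁ p
  to (suc i , p) = inj₂ (i , p)
  from : P zero ⊎ Σ (Fin n) (P ∘ suc) → Σ (Fin (suc n)) P
  from (inj₁ p) = zero , p
  from (inj₂ (i , p)) = suc i , p

Σ-finite : {X : Set} {P : X → Set} → Finite X → (∀ x → Finite (P x)) → Finite (Σ X P)
Σ-finite {X} {P} fX fP = retract-finite
  (λ { (x , p) → enc fX x , subst P (sym (dec-enc fX x)) p })
  (λ { (i , p) → dec fX i , p })
  (λ { (x , p) → pair-≡ (dec-enc fX x) p })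
  (Fin-Σ-finite (fP ∘ dec fX))
  where
  pair-≡ : ∀ {x y} (e : y ≡ x) (p : P x) → (y , subst P (sym e) p) ≡ (x , p)
  pair-≡ refl _ = refl

instance
  ×-finite : {X Y : Set} {{_ : Finite X}} {{_ : Finite Y}} → Finite (X × Y)
  ×-finite {{fX}} {{fY}} = Σ-finite fX (λ _ → fY)

  Bool-finite : Finite Bool
  Bool-finite = retract-finite {Y = ⊤ ⊎ ⊤} (λ { false → inj₁ tt ; true → inj₂ tt })
    [ (λ _ → false) , (λ _ → true) ]′ (λ { false → refl ; true → refl }) ⊎-finite

  Maybe-finite : {X : Set} {{_ : Finite X}} → Finite (Maybe X)
  Maybe-finite {X} = retract-finite {Y = ⊤ ⊎ X} (λ { nothing → inj₁ tt ; (just x) → inj₂ x })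
    [ (λ _ → nothing) , just ]′ (λ { nothing → refl ; (just _) → refl }) ⊎-finite

-- Structured programs

record Model : Set₁ where
  field
    Act   : Set → Set
    State : Set
    sem   : ∀ {X} → Act X → State → X × State

open Model

-- Values passed on by `bind` and `iter` have finite types, so a Turing machine can keep them in its
-- control; unbounded data live only in `State`.
data Prog (𝓜 : Model) : Set → Set₁ where
  ret  : ∀ {X} → X → Prog 𝓜 X
  act  : ∀ {X} → Act 𝓜 X → Prog 𝓜 X
  bind : ∀ {X Y} {{_ : Finite X}} → Prog 𝓜 X → (X → Prog 𝓜 Y) → Prog 𝓜 Y
  iter : ∀ {X Y} {{_ : Finite X}} → (X → Prog 𝓜 (X ⊎ Y)) → X → Prog 𝓜 Y

-- Because of `slack` the index is an upper bound on the time. `ret` is charged one step since it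
-- compiles to a transition of its own, whereas sequencing and looping are free.
data Run {𝓜 : Model} : ∀ {X} → Prog 𝓜 X → State 𝓜 → X → State 𝓜 → ℕ → Set₁ where
  ret   : ∀ {X} {x : X} {s} → Run (ret x) s x s 1
  act   : ∀ {X} {a : Act 𝓜 X} {s x s′} → sem 𝓜 a s ≡ (x , s′) → Run (act a) s x s′ 1
  bind  : ∀ {X Y} {{_ : Finite X}} {p : Prog 𝓜 X} {f : X → Prog 𝓜 Y} {s x s′ y s″ m n} →
          Run p s x s′ m → Run (f x) s′ y s″ n → Run (bind p f) s y s″ (m + n)
  done  : ∀ {X Y} {{_ : Finite X}} {f : X → Prog 𝓜 (X ⊎ Y)} {x s y s′ n} →
          Run (f x) s (inj₂ y) s′ n → Run (iter f x) s y s′ n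
  again : ∀ {X Y} {{_ : Finite X}} {f : X → Prog 𝓜 (X ⊎ Y)} {x s x′ s′ y s″ m n} →
          Run (f x) s (inj₁ x′) s′ m → Run (iter f x′) s′ y s″ n → Run (iter f x) s y s″ (m + n)
  slack : ∀ {X} {p : Prog 𝓜 X} {s x s′ m n} → m ≤ n → Run p s x s′ m → Run p s x s′ n

module _ {𝓜 : Model} (size : State 𝓜 → ℕ)
         (size-act : ∀ {X} (a : Act 𝓜 X) s → size (proj₂ (sem 𝓜 a s)) ≤ suc (size s)) where

  private
    chain : ∀ {a b c} m n → b ≤ a + m → c ≤ b + n → c ≤ a + (m + n)
    chain {a} m n p q = ≤-trans q (≤-trans (+-monoˡ-≤ n p) (≤-reflexive (+-assoc a m n)))

  size-run : ∀ {X} {p : Prog 𝓜 X} {s x s′ n} → Run p s x s′ n → size s′ ≤ size s + n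
  size-run {s = s} ret = m≤m+n (size s) 1
  size-run {s = s} (act {a = a} refl) = ≤-trans (size-act a s) (≤-reflexive (+-comm 1 (size s)))
  size-run (bind {m = m} {n} r r′) = chain m n (size-run r) (size-run r′)
  size-run (done r) = size-run r
  size-run (again {m = m} {n} r r′) = chain m n (size-run r) (size-run r′)
  size-run {s = s} (slack m≤n r) = ≤-trans (size-run r) (+-monoʳ-≤ (size s) m≤n)

-- Simulations between models and their slowdown

record Simulation (𝓐 𝓑 : Model) : Set₁ where
  field
    Rep      : State 𝓐 → State 𝓑 → Set
    size     : State 𝓐 → ℕ
    size-act : ∀ {X} (a : Act 𝓐 X) s → size (proj₂ (sem 𝓐 a s)) ≤ suc (size s)
    code     : ∀ {X} → Act 𝓐 X → Prog 𝓑 X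
    cost     : ℕ
    code-run : ∀ {X} (a : Act 𝓐 X) {s t} → Rep s t →
               Σ (State 𝓑) λ t′ → Rep (proj₂ (sem 𝓐 a s)) t′ ×
                 Run (code a) t (proj₁ (sem 𝓐 a s)) t′ (suc cost * suc (size s))

  translate : ∀ {X} → Prog 𝓐 X → Prog 𝓑 X
  translate (ret x) = ret x
  translate (act a) = code a
  translate (bind p f) = bind (translate p) (λ x → translate (f x))
  translate (iter f x) = iter (λ x → translate (f x)) x

  -- After n actions from a state of size z, no state of size more than z + n has been met.
  time : ℕ → ℕ → ℕ
  time n z = n * (suc cost * suc (z + n))

  time-mono : ∀ {m n y z} → m ≤ n → y ≤ z → time m y ≤ time n z
  time-mono m≤n y≤z = *-mono-≤ m≤n (*-monoʳ-≤ (suc cost) (s≤s (+-mono-≤ y≤z m≤n)))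

  -- The second run starts at a size of at most `z + m`, so in both halves the cost of an action is
  -- bounded by its value at size `z + (m + n)`, which then factors out.
  time-+ : ∀ m n {y z} → y ≤ z + m → time m z + time n y ≤ time (m + n) z
  time-+ m n {y} {z} y≤z+m = ≤-trans
    (+-mono-≤ (*-monoʳ-≤ m (*-monoʳ-≤ (suc cost) (s≤s (+-monoʳ-≤ z (m≤m+n m n)))))
              (*-monoʳ-≤ n (*-monoʳ-≤ (suc cost)
                (s≤s (≤-trans (+-monoˡ-≤ n y≤z+m) (≤-reflexive (+-assoc z m n)))))))
    (≤-reflexive (sym (*-distribʳ-+ (suc cost * suc (z + (m + n))) m n)))

  translate-run : ∀ {X} {p : Prog 𝓐 X} {s x s′ n t} → Run p s x s′ n → Rep s t →
                  Σ (State 𝓑) λ t′ → Rep s′ t′ × Run (translate p) t x t′ (time n (size s))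
  -- The translated `ret` still takes a step; the successors in `time` make room for it.
  translate-run {t = t} ret rep = t , rep , slack (s≤s z≤n) ret
  translate-run {s = s} (act {a = a} refl) rep with code-run a rep
  ... | t′ , rep′ , r = t′ , rep′ , slack
        (≤-trans (*-monoʳ-≤ (suc cost) (s≤s (m≤m+n (size s) 1))) (m≤m+n _ 0)) r
  translate-run (bind {m = m} {n} r r′) rep with translate-run r rep
  ... | t′ , rep′ , q with translate-run r′ rep′
  ...   | t″ , rep″ , q′ = t″ , rep″ , slack (time-+ m n (size-run size size-act r)) (bind q q′)
  translate-run (done r) rep with translate-run r rep
  ... | t′ , rep′ , q = t′ , rep′ , done q
  translate-run (again {m = m} {n} r r′) rep with translate-run r rep
  ... | t′ , rep′ , q with translate-run r′ rep′
  ...   | t″ , rep″ , q′ = t″ , rep″ , slack (time-+ m n (size-run size size-act r)) (again q q′)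
  translate-run {s = s} (slack m≤n r) rep with translate-run r rep
  ... | t′ , rep′ , q = t′ , rep′ , slack (time-mono m≤n (≤-refl {size s})) q

-- Tapes: the cells left of the head, nearest first, and the cells from the head on.

Tape : Set → Set
Tape Γ = List Γ × List Γ

module _ {Γ : Set} (blank : Γ) where

  hd : List Γ → Γ
  hd []      = blank
  hd (g ∷ _) = g

  tl : List Γ → List Γ
  tl []      = []
  tl (_ ∷ r) = r

  shift : Move → Tape Γ → Tape Γ
  shift L ([] , r)    = [] , r
  shift L (g ∷ l , r) = l , g ∷ r
  shift R (l , r)     = hd r ∷ l , tl r
  shift S t           = t

  tapeAct : ∀ {X : Set} → (Γ → Γ × Move × X) → Tape Γ → X × Tape Γ
  tapeAct a (l , r) = let (g , m , x) = a (hd r) in x , shift m (l , g ∷ tl r)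

  tapeModel : Model
  tapeModel = record { Act = λ X → Γ → Γ × Move × X ; State = Tape Γ ; sem = tapeAct }

-- Compilation to Turing machines

Cells : Model
Cells = tapeModel {Sym} nothing

-- A control point inside a continuation or a loop body carries the value `x` with which that code
-- was entered; this is how the machine remembers results.
States : ∀ {X} → Prog Cells X → Set
States (ret _) = ⊤
States (act _) = ⊤
States (bind {X} p f) = States p ⊎ Σ X (λ x → States (f x))
States (iter {X} f _) = Σ X (λ x → States (f x))

States-finite : ∀ {X} (p : Prog Cells X) → Finite (States p)
States-finite (ret _) = ⊤-finite
States-finite (act _) = ⊤-finite
States-finite (bind {{fX}} p f) =
  ⊎-finite {{States-finite p}} {{Σ-finite fX (λ x → States-finite (f x))}}
States-finite (iter {{fX}} f _) = Σ-finite fX (λ x → States-finite (f x))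

entry : ∀ {X} (p : Prog Cells X) → States p
entry (ret _) = tt
entry (act _) = tt
entry (bind p f) = inj₁ (entry p)
entry (iter f x) = x , entry (f x)

Trans : Set → Set → Set
Trans Q X = Q → Sym → Sym × Move × (Q ⊎ X)

redirect : ∀ {Q X Q′ X′ : Set} → (Q → Q′) → (X → Q′ ⊎ X′) → Sym × Move × (Q ⊎ X) → Sym × Move × (Q′ ⊎ X′)
redirect e h (s , m , o) = s , m , [ inj₁ ∘ e , h ]′ o

trans-of : ∀ {X} (p : Prog Cells X) → Trans (States p) X
trans-of (ret x) _ s = s , S , inj₂ x
trans-of (act a) _ s = let (s′ , m , x) = a s in s′ , m , inj₂ x
trans-of (bind p f) (inj₁ q) s =
  redirect inj₁ (λ x → inj₁ (inj₂ (x , entry (f x)))) (trans-of p q s)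
trans-of (bind p f) (inj₂ (x , q)) s = redirect (λ q → inj₂ (x , q)) inj₂ (trans-of (f x) q s)
trans-of (iter f _) (x , q) s =
  redirect (x ,_) [ (λ x′ → inj₁ (x′ , entry (f x′))) , inj₂ ]′ (trans-of (f x) q s)

View : Set
View = List Sym × Sym × List Sym

view : Tape Sym → View
view (l , r) = l , hd nothing r , tl nothing r

scan : View → Sym
scan (_ , h , _) = h

put : Sym → Move → View → View
put g m (l , _ , r) = move m l g r

view-shift : ∀ m l g r → view (shift nothing m (l , g ∷ r)) ≡ move m l g r
view-shift L []      g r       = refl
view-shift L (_ ∷ _) g r       = refl
view-shift R l       g []      = refl
view-shift R l       g (_ ∷ _) = refl
view-shift S l       g r       = refl

data Path {Q X : Set} (d : Trans Q X) : Q → View → X → View → ℕ → Set where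
  exit  : ∀ {q v g m x v′} → d q (scan v) ≡ (g , m , inj₂ x) → put g m v ≡ v′ → Path d q v x v′ 1
  next  : ∀ {q v g m q′ x v′ n} → d q (scan v) ≡ (g , m , inj₁ q′) →
          Path d q′ (put g m v) x v′ n → Path d q v x v′ (suc n)
  slack : ∀ {q v x v′ m n} → m ≤ n → Path d q v x v′ m → Path d q v x v′ n

module _ {Q X Q′ X′ : Set} {d : Trans Q X} {d′ : Trans Q′ X′} (e : Q → Q′) (h : X → Q′ ⊎ X′)
         (eq : ∀ q s → d′ (e q) s ≡ redirect e h (d q s)) where

  path-exit : ∀ {q v x x′ v′ n} → h x ≡ inj₂ x′ → Path d q v x v′ n → Path d′ (e q) v x′ v′ n
  path-exit hx (exit {q} {v} d≡ p≡) = exit (trans (eq q (scan v))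
    (trans (cong (redirect e h) d≡) (cong (λ o → _ , _ , o) hx))) p≡
  path-exit hx (next {q} {v} d≡ π) =
    next (trans (eq q (scan v)) (cong (redirect e h) d≡)) (path-exit hx π)
  path-exit hx (slack m≤n π) = slack m≤n (path-exit hx π)

  -- The exit transition already writes and moves, and `redirect` lets the same transition jump to
  -- the continuation. It turns from `exit` into `next`, so the times add up without overhead.
  path-cont : ∀ {q v x q′ v′ y v″ m n} → h x ≡ inj₁ q′ → Path d q v x v′ m →
              Path d′ q′ v′ y v″ n → Path d′ (e q) v y v″ (m + n)
  path-cont hx (exit {q} {v} d≡ refl) π′ = next (trans (eq q (scan v))
    (trans (cong (redirect e h) d≡) (cong (λ o → _ , _ , o) hx))) π′
  path-cont hx (next {q} {v} d≡ π) π′ =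
    next (trans (eq q (scan v)) (cong (redirect e h) d≡)) (path-cont hx π π′)
  path-cont {n = n} hx (slack m≤n π) π′ = slack (+-monoˡ-≤ n m≤n) (path-cont hx π π′)

run-path : ∀ {X} {p : Prog Cells X} {t x t′ n} → Run p t x t′ n →
           Path (trans-of p) (entry p) (view t) x (view t′) n
run-path ret = exit refl refl
run-path {t = l , r} (act {a = a} refl) =
  exit refl (sym (view-shift (proj₁ (proj₂ (a (hd nothing r)))) l _ (tl nothing r)))
run-path (bind {f = f} r r′) =
  path-cont inj₁ (λ x → inj₁ (inj₂ (x , entry (f x)))) (λ _ _ → refl) refl (run-path r)
    (path-exit (λ q → inj₂ (_ , q)) inj₂ (λ _ _ → refl) refl (run-path r′))
run-path (done {f = f} r) =
  path-exit (_ ,_) [ (λ x → inj₁ (x , entry (f x))) , inj₂ ]′ (λ _ _ → refl) refl (run-path r)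
run-path (again {f = f} r r′) =
  path-cont (_ ,_) [ (λ x → inj₁ (x , entry (f x))) , inj₂ ]′ (λ _ _ → refl) refl
    (run-path r) (run-path r′)
run-path (slack m≤n r) = slack m≤n (run-path r)

config : ∀ {n} → Fin n → View → Config n
config q (l , h , r) = cfg q l h r

step-config : ∀ (M : TM) {q q′ g m} v → TM.δ M q (scan v) ≡ just (q′ , g , m) →
              step M (config q v) ≡ just (config q′ (put g m v))
step-config M (l , h , r) δ≡ rewrite δ≡ = refl

step-halt : ∀ (M : TM) {q} v → TM.δ M q (scan v) ≡ nothing → step M (config q v) ≡ nothing
step-halt M (l , h , r) δ≡ rewrite δ≡ = refl

exec-halt : ∀ M n {c} → step M c ≡ nothing → exec M n c ≡ just c
exec-halt M n s≡ rewrite s≡ = refl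

exec-step : ∀ M n {c c′} → step M c ≡ just c′ → exec M (suc n) c ≡ exec M n c′
exec-step M n s≡ rewrite s≡ = refl

exec-mono : ∀ M {m n c c′} → m ≤ n → exec M m c ≡ just c′ → exec M n c ≡ just c′
exec-mono M {c = c} m≤n e with step M c
exec-mono M m≤n e | nothing = e
exec-mono M (s≤s m≤n) e | just _ = exec-mono M m≤n e

initial-config : ∀ M w → initial M w ≡ config (TM.start M) (view ([] , map just w))
initial-config M []      = refl
initial-config M (_ ∷ _) = refl

module Compile {X : Set} (p : Prog Cells X) (fin : Finite (Maybe (States p))) where

  -- `nothing` is an extra halting state: a machine stops where its table is undefined, yet the last
  -- transition of a program must still write and move.
  target : States p ⊎ X → Maybe (States p)
  target (inj₁ q) = just q
  target (inj₂ _) = nothing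

  trans? : Maybe (States p) → Sym → Maybe (Fin (card fin) × Sym × Move)
  trans? nothing  _ = nothing
  trans? (just q) s = let (g , m , o) = trans-of p q s in just (enc fin (target o) , g , m)

  toTM : TM
  toTM = record { nQ = card fin ; start = enc fin (just (entry p)) ; δ = λ i → trans? (dec fin i) }

  conf : Maybe (States p) → View → Config (card fin)
  conf q v = config (enc fin q) v

  δ-enc : ∀ q s → TM.δ toTM (enc fin q) s ≡ trans? q s
  δ-enc q s = cong (λ q → trans? q s) (dec-enc fin q)

  step-enc : ∀ {q g m o} v → trans-of p q (scan v) ≡ (g , m , o) →
             step toTM (conf (just q) v) ≡ just (conf (target o) (put g m v))
  step-enc {q} v eq = step-config toTM {enc fin (just q)} v (trans (δ-enc (just q) (scan v))
    (cong (λ { (g , m , o) → just (enc fin (target o) , g , m) }) eq))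

  exec-path : ∀ {q v x v′ n} → Path (trans-of p) q v x v′ n →
              exec toTM n (conf (just q) v) ≡ just (conf nothing v′)
  exec-path {q} {v} {v′ = v′} (exit d≡ refl) =
    trans (exec-step toTM 0 {conf (just q) v} {conf nothing v′} (step-enc v d≡))
      (exec-halt toTM 0 {conf nothing v′} (step-halt toTM {enc fin nothing} v′ (δ-enc nothing _)))
  exec-path {q} {v} (next {g = g} {m} {q′} {n = n} d≡ π) =
    trans (exec-step toTM n {conf (just q) v} {conf (just q′) (put g m v)} (step-enc v d≡)) (exec-path π)
  exec-path {q} {v} (slack m≤n π) = exec-mono toTM {c = conf (just q) v} m≤n (exec-path π)

  readOut-view : ∀ r → readOut (hd nothing r ∷ tl nothing r) ≡ readOut r
  readOut-view []      = refl
  readOut-view (_ ∷ _) = refl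

  toTM-output : ∀ {w x l r n} → Run p ([] , map just w) x (l , r) n →
                Maybe.map output (exec toTM n (initial toTM w)) ≡ just (readOut r)
  toTM-output {w} {r = r} {n} π = trans
    (cong (Maybe.map output) (trans (cong (exec toTM n) (initial-config toTM w)) (exec-path (run-path π))))
    (cong just (readOut-view r))

-- Letters: pairs of cells

Elem : Set
Elem = Bool × Sym

data Letter : Set where
  blank home : Letter
  cell       : Maybe Elem → Letter

pattern sep  = cell nothing
pattern el e = cell (just e)

-- The images of encodeList are concatenations of the codes of elements (false , just b) and
-- (true , just true).
encode : Letter → Sym × Sym
encode blank        = nothing , nothing
encode home         = nothing , just true
encode sep          = nothing , just false
encode (el (b , s)) = just b , s

decode : Sym → Sym → Letter
decode nothing nothing      = blank
decode nothing (just true)  = home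
decode nothing (just false) = sep
decode (just b) s           = el (b , s)

decode-encode : ∀ g → decode (proj₁ (encode g)) (proj₂ (encode g)) ≡ g
decode-encode blank  = refl
decode-encode home   = refl
decode-encode sep    = refl
decode-encode (el _) = refl

instance
  Letter-finite : Finite Letter
  Letter-finite = retract-finite encode (λ { (s , s′) → decode s s′ }) decode-encode ×-finite

Letters : Model
Letters = tapeModel blank

spread : List Letter → List Sym
spread []      = []
spread (g ∷ r) = proj₁ (encode g) ∷ proj₂ (encode g) ∷ spread r

spreadˡ : List Letter → List Sym
spreadˡ []      = []
spreadˡ (g ∷ l) = proj₂ (encode g) ∷ proj₁ (encode g) ∷ spreadˡ l

twice : Move → Prog Cells ⊤
twice m = bind (act (λ s → s , m , tt)) λ _ → act (λ s → s , m , tt)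

-- Entered with the head on the second cell of the block, so the block is written from right to
-- left. At the left end both steps of `twice L` stay put, as the letter move does.
writeBlock : ∀ {X} → Letter × Move × X → Prog Cells X
writeBlock (g , m , x) =
  bind (act (λ _ → proj₂ (encode g) , L , tt)) λ _ →
  bind (act (λ _ → proj₁ (encode g) , S , tt)) λ _ →
  bind (twice m) λ _ →
  ret x

letterCode : ∀ {X} → Act Letters X → Prog Cells X
letterCode a =
  bind (act (λ s → s , R , s)) λ s →
  bind (act (λ s′ → s′ , S , s′)) λ s′ →
  writeBlock (a (decode s s′))

writeBlock-run : ∀ {X} g m (x : X) s s′ l r →
  Run (writeBlock (g , m , x)) (s ∷ spreadˡ l , s′ ∷ spread r) x
      (spreadˡ (proj₁ (shift blank m (l , g ∷ r))) , spread (proj₂ (shift blank m (l , g ∷ r)))) 5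
writeBlock-run g L x s s′ []      r       = bind (act refl) (bind (act refl) (bind (bind (act refl) (act refl)) ret))
writeBlock-run g L x s s′ (_ ∷ _) r       = bind (act refl) (bind (act refl) (bind (bind (act refl) (act refl)) ret))
writeBlock-run g R x s s′ l       r       = bind (act refl) (bind (act refl) (bind (bind (act refl) (act refl)) ret))
writeBlock-run g S x s s′ l       r       = bind (act refl) (bind (act refl) (bind (bind (act refl) (act refl)) ret))

letterCode-run : ∀ {X} (a : Act Letters X) l r →
  let (x , l′ , r′) = sem Letters a (l , r) in
  Run (letterCode a) (spreadˡ l , spread r) x (spreadˡ l′ , spread r′) 7
letterCode-run a l [] = bind (act refl) (bind (act refl) (writeBlock-run _ _ _ nothing nothing l []))
letterCode-run a l (g ∷ r) = bind (act refl) (bind (act refl)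
  (subst (λ h → Run (writeBlock (a h)) (proj₁ (encode g) ∷ spreadˡ l , proj₂ (encode g) ∷ spread r)
                    x (spreadˡ l′ , spread r′) 5)
    (sym (decode-encode g)) (writeBlock-run (proj₁ (a g)) (proj₁ (proj₂ (a g))) x _ _ l r)))
  where
  x  = proj₁ (sem Letters a (l , g ∷ r))
  l′ = proj₁ (proj₂ (sem Letters a (l , g ∷ r)))
  r′ = proj₂ (proj₂ (sem Letters a (l , g ∷ r)))

letterSim : Simulation Letters Cells
letterSim = record
  { Rep      = λ { (l , r) t → t ≡ (spreadˡ l , spread r) }
  -- A letter action takes seven steps wherever the head is; with size 0 the bound
  -- `suc cost * suc size` is exactly seven.
  ; size     = λ _ → 0
  ; size-act = λ _ _ → z≤n
  ; code     = letterCode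
  ; cost     = 6
  ; code-run = λ { a {l , r} refl → _ , refl , letterCode-run a l r } }

-- Tapes up to trailing blanks

module _ {Γ : Set} (b : Γ) where

  nth : List Γ → ℕ → Γ
  nth []      _       = b
  nth (g ∷ _) zero    = g
  nth (_ ∷ r) (suc n) = nth r n

  _≃_ : List Γ → List Γ → Set
  r ≃ r′ = ∀ n → nth r n ≡ nth r′ n

  hd-≃ : ∀ r r′ → r ≃ r′ → hd b r ≡ hd b r′
  hd-≃ []      []      e = refl
  hd-≃ []      (_ ∷ _) e = e 0
  hd-≃ (_ ∷ _) []      e = e 0
  hd-≃ (_ ∷ _) (_ ∷ _) e = e 0

  tl-≃ : ∀ r r′ → r ≃ r′ → tl b r ≃ tl b r′
  tl-≃ []      []      e n = refl
  tl-≃ []      (_ ∷ _) e n = e (suc n)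
  tl-≃ (_ ∷ _) []      e n = e (suc n)
  tl-≃ (_ ∷ _) (_ ∷ _) e n = e (suc n)

  ∷-≃ : ∀ {g r r′} → r ≃ r′ → (g ∷ r) ≃ (g ∷ r′)
  ∷-≃ e zero    = refl
  ∷-≃ e (suc n) = e n

  shift-≃ : ∀ m l {r r′} → r ≃ r′ →
            Σ (List Γ) λ r″ → proj₂ (shift b m (l , r)) ≃ r″ ×
              shift b m (l , r′) ≡ (proj₁ (shift b m (l , r)) , r″)
  shift-≃ L []      e = _ , e , refl
  shift-≃ L (_ ∷ _) e = _ , ∷-≃ e , refl
  shift-≃ R l {r} {r′} e = _ , tl-≃ r r′ e , cong (λ g → g ∷ l , tl b r′) (sym (hd-≃ r r′ e))
  shift-≃ S l       e = _ , e , refl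

  -- Cells are read through `hd`, which treats a missing cell as blank, so a run cannot notice
  -- trailing blanks. Insertions and deletions leave such blanks behind, and stack contents fix the
  -- tape only up to them.
  run-≃ : ∀ {X} {p : Prog (tapeModel b) X} {t x t′ n r} → Run p t x t′ n → proj₂ t ≃ r →
          Σ (List Γ) λ r′ → proj₂ t′ ≃ r′ × Run p (proj₁ t , r) x (proj₁ t′ , r′) n
  run-≃ {r = r} ret e = r , e , ret
  run-≃ {t = l , r₀} {r = r} (act {a = a} refl) e
    with shift-≃ (proj₁ (proj₂ (a (hd b r₀)))) l (∷-≃ {g = proj₁ (a (hd b r₀))} (tl-≃ r₀ r e))
  ... | r′ , e′ , sh = r′ , e′ , act (trans
        (cong (λ h → proj₂ (proj₂ (a h)) , shift b (proj₁ (proj₂ (a h))) (l , proj₁ (a h) ∷ tl b r))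
              (sym (hd-≃ r₀ r e)))
        (cong (_ ,_) sh))
  run-≃ (bind q q′) e with run-≃ q e
  ... | _ , e′ , π with run-≃ q′ e′
  ...   | r″ , e″ , π′ = r″ , e″ , bind π π′
  run-≃ (done q) e with run-≃ q e
  ... | r′ , e′ , π = r′ , e′ , done π
  run-≃ (again q q′) e with run-≃ q e
  ... | _ , e′ , π with run-≃ q′ e′
  ...   | r″ , e″ , π′ = r″ , e″ , again π π′
  run-≃ (slack m≤n q) e with run-≃ q e
  ... | r′ , e′ , π = r′ , e′ , slack m≤n π

-- Stacks on a tape of letters

data StackAct (k : ℕ) : Set → Set where
  push : Fin (suc k) → Elem → StackAct k ⊤
  pop  : Fin (suc k) → StackAct k (Maybe Elem)

StackState : ℕ → Set
StackState k = Vec (List Elem) (suc k)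

popped : ∀ {k} → Fin (suc k) → StackState k → List Elem → Maybe Elem × StackState k
popped j s []       = nothing , s
popped j s (e ∷ es) = just e , s [ j ]≔ es

stackAct : ∀ {k X} → StackAct k X → StackState k → X × StackState k
stackAct (push j e) s = tt , s [ j ]≔ (e ∷ lookup s j)
stackAct (pop j)    s = popped j s (lookup s j)

Stacks : ℕ → Model
Stacks k = record { Act = StackAct k ; State = StackState k ; sem = stackAct }

flat : ∀ {k} → StackState k → List (Maybe Elem)
flat (s ∷ [])      = map just s
flat (s ∷ s′ ∷ ss) = map just s ++ nothing ∷ flat (s′ ∷ ss)

before : ∀ {k} → Fin (suc k) → StackState k → List (Maybe Elem)
before zero    _             = []
before (suc j) (s ∷ s′ ∷ ss) = map just s ++ nothing ∷ before j (s′ ∷ ss)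

after : ∀ {k} → Fin (suc k) → StackState k → List (Maybe Elem)
after zero    (s ∷ [])      = []
after zero    (s ∷ s′ ∷ ss) = nothing ∷ flat (s′ ∷ ss)
after (suc j) (s ∷ s′ ∷ ss) = after j (s′ ∷ ss)

flat-lookup : ∀ {k} j (ss : StackState k) → flat ss ≡ before j ss ++ map just (lookup ss j) ++ after j ss
flat-lookup zero    (s ∷ [])      = sym (++-identityʳ _)
flat-lookup zero    (s ∷ s′ ∷ ss) = refl
flat-lookup (suc j) (s ∷ s′ ∷ ss) =
  trans (cong (λ r → map just s ++ nothing ∷ r) (flat-lookup j (s′ ∷ ss)))
        (sym (++-assoc (map just s) (nothing ∷ before j (s′ ∷ ss)) _))

flat-update : ∀ {k} j (ss : StackState k) xs → flat (ss [ j ]≔ xs) ≡ before j ss ++ map just xs ++ after j ss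
flat-update zero    (s ∷ [])      xs = sym (++-identityʳ _)
flat-update zero    (s ∷ s′ ∷ ss) xs = refl
flat-update (suc zero) (s ∷ s′ ∷ ss) xs =
  trans (cong (λ r → map just s ++ nothing ∷ r) (flat-update zero (s′ ∷ ss) xs))
        (sym (++-assoc (map just s) (nothing ∷ []) _))
flat-update (suc (suc j)) (s ∷ s′ ∷ s″ ∷ ss) xs =
  trans (cong (λ r → map just s ++ nothing ∷ r) (flat-update (suc j) (s′ ∷ s″ ∷ ss) xs))
        (sym (++-assoc (map just s) (nothing ∷ before (suc j) (s′ ∷ s″ ∷ ss)) _))

goStep : Letter → Letter × Move × (⊤ ⊎ ⊤)
goStep home = home , S , inj₂ tt
goStep g    = g , L , inj₁ tt

goHome : Prog Letters ⊤
goHome = iter (λ _ → act goStep) tt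

skipStep : Letter → Letter × Move × (⊤ ⊎ ⊤)
skipStep sep = sep , R , inj₂ tt
skipStep g   = g , R , inj₁ tt

skipSep : Prog Letters ⊤
skipSep = iter (λ _ → act skipStep) tt

skip : ℕ → Prog Letters ⊤
skip zero    = ret tt
skip (suc n) = bind skipSep λ _ → skip n

-- The loop variable is the letter displaced from the previous cell, to be dropped on the current
-- one.
insertStep : Letter → Letter → Letter × Move × (Letter ⊎ ⊤)
insertStep c blank = c , R , inj₂ tt
insertStep c g     = c , R , inj₁ g

insert : Letter → Prog Letters ⊤
insert = iter (λ c → act (insertStep c))

pullStep : Letter → Letter × Move × (⊤ ⊎ ⊤)
pullStep blank = blank , S , inj₂ tt
pullStep g     = g , R , inj₁ tt

-- Each round copies the right neighbour over the current cell and stops once a blank has been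
-- copied. The copied blank and the blank it came from both remain as explicit cells.
delete : Prog Letters ⊤
delete = iter (λ _ →
  bind (act (λ g → g , R , tt)) λ _ →
  bind (act (λ g → g , L , g)) λ g →
  act (λ _ → pullStep g)) tt

takeElem : Letter → Prog Letters (Maybe Elem)
takeElem (el e) = bind delete λ _ → bind goHome λ _ → ret (just e)
takeElem _      = bind goHome λ _ → ret nothing

goStack : ℕ → Prog Letters ⊤
goStack n = bind (act (λ g → g , R , tt)) λ _ → skip n

stackCode : ∀ {k X} → StackAct k X → Prog Letters X
stackCode (push j e) = bind (goStack (toℕ j)) λ _ → bind (insert (el e)) λ _ → goHome
stackCode (pop j)    = bind (goStack (toℕ j)) λ _ → bind (act (λ g → g , S , g)) takeElem

-- The hypothesis says that the head does not start on `home`. The induction `leftwards` must meet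
-- the cells in the order of the head's journey, hence it runs over the reversed word and is
-- converted afterwards.
goHome-run : ∀ ws r → goStep (hd blank r) ≡ (hd blank r , L , inj₁ tt) →
  Run goHome (map cell ws ʳ++ home ∷ [] , r) tt
      ([] , home ∷ map cell ws ++ hd blank r ∷ tl blank r) (2 + length ws)
goHome-run ws r eq = subst₂ (λ l r′ → Run goHome (l , r) tt ([] , home ∷ r′) (2 + length ws))
  (trans (cong (_++ home ∷ []) (reverse-map ws)) (sym (ʳ++-defn (map cell ws))))
  (trans (cong (_ʳ++ _) (reverse-map ws)) (ʳ++-ʳ++ (map cell ws)))
  (subst (λ n → Run goHome (map cell (reverse ws) ++ home ∷ [] , r) tt
      ([] , home ∷ map cell (reverse ws) ʳ++ (hd blank r ∷ tl blank r)) (2 + n))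
    (trans (length-ʳ++ ws) (+-identityʳ _)) (leftwards (reverse ws) r eq))
  where
  reverse-map : ∀ xs → map cell (reverse xs) ≡ reverse (map cell xs)
  reverse-map xs = map-ʳ++ cell xs
  leftwards : ∀ zs r → goStep (hd blank r) ≡ (hd blank r , L , inj₁ tt) →
    Run goHome (map cell zs ++ home ∷ [] , r) tt
        ([] , home ∷ map cell zs ʳ++ (hd blank r ∷ tl blank r)) (2 + length zs)
  leftwards [] r eq = again (act (cong (λ { (g , m , x) → x , shift blank m (home ∷ [] , g ∷ tl blank r) }) eq))
    (done (act refl))
  leftwards (z ∷ zs) r eq = again
    (act (cong (λ { (g , m , x) → x , shift blank m (cell z ∷ map cell zs ++ home ∷ [] , g ∷ tl blank r) }) eq))
    (leftwards zs (cell z ∷ hd blank r ∷ tl blank r) (goStep-cell z))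
    where
    goStep-cell : ∀ z → goStep (cell z) ≡ (cell z , L , inj₁ tt)
    goStep-cell nothing  = refl
    goStep-cell (just _) = refl

skipSep-run : ∀ xs l r → Run skipSep (l , map cell (map just xs) ++ sep ∷ r) tt
  (sep ∷ (map cell (map just xs) ʳ++ l) , r) (suc (length xs))
skipSep-run []       l r = done (act refl)
skipSep-run (x ∷ xs) l r = again (act refl) (skipSep-run xs (el x ∷ l) r)

skip-run : ∀ {k} j (ss : StackState k) l r →
  Run (skip (toℕ j)) (l , map cell (before j ss) ++ r) tt (map cell (before j ss) ʳ++ l , r)
      (suc (length (before j ss)))
skip-run zero    ss            l r = ret
skip-run (suc j) (s ∷ s′ ∷ ss) l r
  rewrite map-++ cell (map just s) (nothing ∷ before j (s′ ∷ ss))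
        | ++-assoc (map cell (map just s)) (sep ∷ map cell (before j (s′ ∷ ss))) r
        | ++-ʳ++ (map cell (map just s)) {sep ∷ map cell (before j (s′ ∷ ss))} {l}
        | length-++ (map just s) {nothing ∷ before j (s′ ∷ ss)}
        | length-map just s
  = bind (skipSep-run s l _) (skip-run j (s′ ∷ ss) _ r)

insert-run : ∀ c l ys → Run (insert c) (l , map cell ys) tt ((c ∷ map cell ys) ʳ++ l , []) (suc (length ys))
insert-run c l []             = done (act refl)
insert-run c l (nothing ∷ ys) = again (act refl) (insert-run sep (c ∷ l) ys)
insert-run c l (just e ∷ ys)  = again (act refl) (insert-run (el e) (c ∷ l) ys)

delete-run : ∀ g l ys → Run delete (l , g ∷ map cell ys) tt (map cell ys ʳ++ l , blank ∷ blank ∷ [])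
  (3 + length ys * 3)
delete-run g l []             = done (bind (act refl) (bind (act refl) (act refl)))
delete-run g l (nothing ∷ ys) =
  again (bind (act refl) (bind (act refl) (act refl))) (delete-run sep (sep ∷ l) ys)
delete-run g l (just e ∷ ys)  =
  again (bind (act refl) (bind (act refl) (act refl))) (delete-run (el e) (el e ∷ l) ys)

ʳ++-join : ∀ b ys → map cell ys ʳ++ (map cell b ʳ++ home ∷ []) ≡ map cell (b ++ ys) ʳ++ home ∷ []
ʳ++-join b ys = trans (sym (++-ʳ++ (map cell b))) (cong (_ʳ++ home ∷ []) (sym (map-++ cell b ys)))

insertHome-run : ∀ b y ys →
  Run (bind (insert (cell y)) λ _ → goHome) (map cell b ʳ++ home ∷ [] , map cell ys) tt
      ([] , home ∷ map cell (b ++ y ∷ ys) ++ blank ∷ []) (suc (length ys) + (2 + length (b ++ y ∷ ys)))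
insertHome-run b y ys = bind (insert-run (cell y) _ ys)
  (subst (λ l → Run goHome (l , []) tt ([] , home ∷ map cell (b ++ y ∷ ys) ++ blank ∷ [])
                      (2 + length (b ++ y ∷ ys)))
    (sym (ʳ++-join b (y ∷ ys))) (goHome-run (b ++ y ∷ ys) [] refl))

goStack-run : ∀ {k} j (ss : StackState k) ys →
  Run (goStack (toℕ j)) ([] , home ∷ map cell (before j ss ++ ys)) tt
      (map cell (before j ss) ʳ++ home ∷ [] , map cell ys) (2 + length (before j ss))
goStack-run j ss ys rewrite map-++ cell (before j ss) ys =
  bind (act refl) (skip-run j ss (home ∷ []) (map cell ys))

size : ∀ {k} → StackState k → ℕ
size s = length (flat s)

private
  -- Naming the surplus `k` turns an inequality between polynomials into an equation for the ring
  -- solver.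
  atMost : ∀ {m n} k → m + k ≡ n → m ≤ n
  atMost {m} k refl = m≤m+n m k

Layout : ∀ {k} → StackState k → Tape Letter → Set
Layout s (l , r) = l ≡ [] × (_≃_ blank (home ∷ map cell (flat s)) r)

ends : List (Maybe Elem) → List Letter → List Letter
ends ws r = home ∷ map cell ws ++ r

drop-blank : ∀ ws → _≃_ blank (home ∷ map cell ws) (ends ws (blank ∷ []))
drop-blank ws = ∷-≃ blank (go (map cell ws))
  where
  go : ∀ xs → _≃_ blank xs (xs ++ blank ∷ [])
  go [] zero    = refl
  go [] (suc n) = refl
  go (x ∷ xs)   = ∷-≃ blank (go xs)

drop-blanks : ∀ ws → _≃_ blank (home ∷ map cell ws) (ends ws (blank ∷ blank ∷ []))
drop-blanks ws = ∷-≃ blank (go (map cell ws))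
  where
  go : ∀ xs → _≃_ blank xs (xs ++ blank ∷ blank ∷ [])
  go [] zero          = refl
  go [] (suc zero)    = refl
  go [] (suc (suc n)) = refl
  go (x ∷ xs)         = ∷-≃ blank (go xs)

-- When stack `j` is empty, the head standing at its place sees what follows it: a blank or a
-- separator, never an element. This is how `takeElem` recognises an empty stack.
after-shape : ∀ {k} j (ss : StackState k) → after j ss ≡ [] ⊎ Σ _ λ r → after j ss ≡ nothing ∷ r
after-shape zero    (s ∷ [])      = inj₁ refl
after-shape zero    (s ∷ s′ ∷ ss) = inj₂ (_ , refl)
after-shape (suc j) (s ∷ s′ ∷ ss) = after-shape j (s′ ∷ ss)

push-cost : ∀ b y → 2 + b + (suc y + (2 + (b + suc y))) ≤ 10 * suc (b + y)
push-cost b y = atMost (4 + 8 * b + 8 * y)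
  (solve 2 (λ b y → con 2 :+ b :+ (con 1 :+ y :+ (con 2 :+ (b :+ (con 1 :+ y)))) :+ (con 4 :+ con 8 :* b :+ con 8 :* y)
     := con 10 :* (con 1 :+ (b :+ y))) refl b y)
  where open +-*-Solver

pop-cost : ∀ b y → 2 + b + (1 + (3 + y * 3 + (2 + (b + y) + 1))) ≤ 10 * suc (b + suc y)
pop-cost b y = atMost (11 + 8 * b + 6 * y)
  (solve 2 (λ b y → con 2 :+ b :+ (con 1 :+ (con 3 :+ y :* con 3 :+ (con 2 :+ (b :+ y) :+ con 1))) :+ (con 11 :+ con 8 :* b :+ con 6 :* y)
     := con 10 :* (con 1 :+ (b :+ (con 1 :+ y)))) refl b y)
  where open +-*-Solver

miss-cost : ∀ b y → 2 + b + (1 + (2 + b + 1)) ≤ 10 * suc (b + y)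
miss-cost b y = atMost (4 + 8 * b + 10 * y)
  (solve 2 (λ b y → con 2 :+ b :+ (con 1 :+ (con 2 :+ b :+ con 1)) :+ (con 4 :+ con 8 :* b :+ con 10 :* y)
     := con 10 :* (con 1 :+ (b :+ y))) refl b y)
  where open +-*-Solver

StackCodeRun : ∀ {k X} → StackAct k X → StackState k → X × StackState k → Set₁
StackCodeRun a s (x , s′) = Σ (List Letter) λ r →
  _≃_ blank (home ∷ map cell (flat s′)) r ×
  Run (stackCode a) ([] , home ∷ map cell (flat s)) x ([] , r) (10 * suc (size s))

stackCode-run : ∀ {k X} (a : StackAct k X) s → StackCodeRun a s (stackAct a s)
stackCode-run (push j e) s
  rewrite flat-update j s (e ∷ lookup s j) | flat-lookup j s =
  _ , drop-blank (b ++ just e ∷ ys) ,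
  slack (subst₂ (λ n m → 2 + length b + (suc (length ys) + (2 + n)) ≤ 10 * suc m)
           (sym (length-++ b)) (sym (length-++ b)) (push-cost (length b) (length ys)))
    (bind (goStack-run j s ys) (insertHome-run b (just e) ys))
  where
  b  = before j s
  ys = map just (lookup s j) ++ after j s
stackCode-run (pop j) s with lookup s j in eq
... | e ∷ es rewrite flat-update j s es | flat-lookup j s | eq =
  _ , drop-blanks (b ++ ys) ,
  slack (subst₂ (λ n m → 2 + length b + (1 + (3 + length ys * 3 + (2 + n + 1))) ≤ 10 * suc m)
           (sym (length-++ b)) (sym (length-++ b)) (pop-cost (length b) (length ys)))
    (bind (goStack-run j s (just e ∷ ys)) (bind (act refl) (bind (delete-run (el e) _ ys) (bind
      (subst (λ l → Run goHome (l , blank ∷ blank ∷ []) tt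
                ([] , ends (b ++ ys) (blank ∷ blank ∷ [])) (2 + length (b ++ ys)))
        (sym (ʳ++-join b ys)) (goHome-run (b ++ ys) (blank ∷ blank ∷ []) refl))
      ret))))
  where
  b  = before j s
  ys = map just es ++ after j s
... | [] rewrite flat-lookup j s | eq with after-shape j s
...   | inj₁ aft rewrite aft | ++-identityʳ (before j s) =
  _ , drop-blank b ,
  slack (≤-trans (miss-cost (length b) 0) (≤-reflexive (cong (λ n → 10 * suc n) (+-identityʳ _))))
    (bind (subst (λ w → Run (goStack (toℕ j)) ([] , home ∷ map cell w) tt
             (map cell b ʳ++ home ∷ [] , []) (2 + length b)) (++-identityʳ b) (goStack-run j s []))
      (bind (act refl) (bind (goHome-run b (blank ∷ []) refl) ret)))
  where
  b = before j s
...   | inj₂ (ys , aft) rewrite aft =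
  _ , (λ n → cong (λ r → nth blank (home ∷ r) n) (map-++ cell b (nothing ∷ ys))) ,
  slack (subst (λ m → 2 + length b + (1 + (2 + length b + 1)) ≤ 10 * suc m)
           (sym (length-++ b)) (miss-cost (length b) (suc (length ys))))
    (bind (goStack-run j s (nothing ∷ ys))
      (bind (act refl) (bind (goHome-run b (sep ∷ map cell ys) refl) ret)))
  where
  b = before j s

size-act : ∀ {k X} (a : StackAct k X) s → size (proj₂ (stackAct a s)) ≤ suc (size s)
size-act (push j e) s rewrite flat-update j s (e ∷ lookup s j) | flat-lookup j s
  | length-++ (before j s) {just e ∷ map just (lookup s j) ++ after j s}
  | length-++ (before j s) {map just (lookup s j) ++ after j s} = ≤-reflexive (+-suc _ _)
size-act (pop j) s with lookup s j in eq
... | [] = n≤1+n _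
... | e ∷ es rewrite flat-update j s es | flat-lookup j s | eq
  | length-++ (before j s) {just e ∷ map just es ++ after j s}
  | length-++ (before j s) {map just es ++ after j s} =
  ≤-trans (+-monoʳ-≤ (length (before j s)) (n≤1+n _)) (n≤1+n _)

stackSim : ∀ k → Simulation (Stacks k) Letters
stackSim k = record
  { Rep      = Layout
  ; size     = size
  ; size-act = size-act
  ; code     = stackCode
  ; cost     = 9
  ; code-run = λ { a {s} {[] , r} (refl , lay) → lift a s r lay } }
  where
  lift : ∀ {X} (a : StackAct k X) s r → _≃_ blank (home ∷ map cell (flat s)) r →
         Σ (Tape Letter) λ t′ → Layout (proj₂ (stackAct a s)) t′ ×
           Run (stackCode a) ([] , r) (proj₁ (stackAct a s)) t′ (10 * suc (size s))
  lift a s r lay with stackCode-run a s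
  ... | r₁ , lay₁ , run with run-≃ blank run lay
  ...   | r₂ , lay₂ , run₂ = ([] , r₂) , (refl , λ n → trans (lay₁ n) (lay₂ n)) , run₂

-- Polynomial bounds

-- With base `suc n` a power grows with its exponent even at `n = 0`, so sums and products may
-- simply add the degrees.
record Poly (f : ℕ → ℕ) : Set where
  constructor poly
  field
    coeff degree : ℕ
    bounded      : ∀ n → f n ≤ coeff * suc n ^ degree

poly-const : ∀ c → Poly (λ _ → c)
poly-const c = poly c 0 λ _ → ≤-reflexive (sym (*-identityʳ c))

poly-id : Poly id
poly-id = poly 1 1 λ n → ≤-trans (n≤1+n n) (≤-reflexive (sym (trans (*-identityˡ _) (*-identityʳ _))))

poly-+ : ∀ {f g} → Poly f → Poly g → Poly (λ n → f n + g n)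
poly-+ {f} {g} (poly c k p) (poly d l q) = poly (c + d) (k + l) λ n → ≤-trans
  (+-mono-≤ (≤-trans (p n) (*-monoʳ-≤ c (^-monoʳ-≤ (suc n) (m≤m+n k l))))
            (≤-trans (q n) (*-monoʳ-≤ d (^-monoʳ-≤ (suc n) (m≤n+m l k)))))
  (≤-reflexive (sym (*-distribʳ-+ (suc n ^ (k + l)) c d)))

poly-* : ∀ {f g} → Poly f → Poly g → Poly (λ n → f n * g n)
poly-* {f} {g} (poly c k p) (poly d l q) = poly (c * d) (k + l) λ n → ≤-trans
  (*-mono-≤ (p n) (q n))
  (≤-reflexive (trans ([m*n]*[o*p]≡[m*o]*[n*p] c (suc n ^ k) d (suc n ^ l))
    (cong (c * d *_) (sym (^-distribˡ-+-* (suc n) k l)))))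

poly-suc : ∀ {f} → Poly f → Poly (suc ∘ f)
poly-suc = poly-+ (poly-const 1)

poly-^ : ∀ {f} → Poly f → ∀ k → Poly (λ n → f n ^ k)
poly-^ p zero    = poly-const 1
poly-^ p (suc k) = poly-* p (poly-^ p k)

^-distribʳ-* : ∀ k m n → (m * n) ^ k ≡ m ^ k * n ^ k
^-distribʳ-* zero    m n = refl
^-distribʳ-* (suc k) m n = trans (cong (m * n *_) (^-distribʳ-* k m n))
  ([m*n]*[o*p]≡[m*o]*[n*p] m n (m ^ k) (n ^ k))

-- For positive `n`, `n + 1 ≤ 2 * n` costs a factor `2 ^ k`; the value at 0 is absorbed by the
-- additive constant.
poly-bound : ∀ {f} → Poly f → Σ ℕ λ c → Σ ℕ λ k → ∀ n → f n ≤ c * n ^ k + c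
poly-bound {f} (poly c k p) = c * 2 ^ k , k , λ n → ≤-trans (p n) (go n)
  where
  go : ∀ n → c * suc n ^ k ≤ c * 2 ^ k * n ^ k + c * 2 ^ k
  go zero = ≤-trans (*-monoʳ-≤ c (^-monoˡ-≤ k {1} {2} (s≤s z≤n))) (m≤n+m _ _)
  go (suc n) = ≤-trans (*-monoʳ-≤ c (^-monoˡ-≤ k {suc (suc n)} {2 * suc n}
      (≤-trans (s≤s (m≤n+m (suc n) n)) (≤-reflexive (cong (suc n +_) (sym (+-identityʳ (suc n))))))))
    (≤-trans (≤-reflexive (trans (cong (c *_) (^-distribʳ-* k 2 (suc n))) (sym (*-assoc c _ _)))) (m≤m+n _ _))

-- Loops over a stack

module _ {k : ℕ} where

  forEach : {Q : Set} {{_ : Finite Q}} → Fin (suc k) → (Q → Elem → Prog (Stacks k) Q) → Q → Prog (Stacks k) Q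
  forEach {Q} i body = iter λ q → bind (act (pop i)) (turn q)
    where
    turn : Q → Maybe Elem → Prog (Stacks k) (Q ⊎ Q)
    turn q nothing  = ret (inj₂ q)
    turn q (just e) = bind (body q e) λ q → ret (inj₁ q)

  module _ {Q Acc : Set} {{_ : Finite Q}} {i : Fin (suc k)} {body : Q → Elem → Prog (Stacks k) Q}
           (st : Acc → List Elem → StackState k) (nxt : Q × Acc → Elem → Q × Acc) (c : ℕ)
           (lookup-st : ∀ a xs → lookup (st a xs) i ≡ xs)
           (update-st : ∀ a xs ys → st a xs [ i ]≔ ys ≡ st a ys)
           (body-run : ∀ q a e es → Run (body q e) (st a es) (proj₁ (nxt (q , a) e)) (st (proj₂ (nxt (q , a) e)) es) c)
           where

    private
      pop-nil : ∀ a → stackAct (pop i) (st a []) ≡ (nothing , st a [])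
      pop-nil a = cong (popped i (st a [])) (lookup-st a [])

      pop-cons : ∀ a e es → stackAct (pop i) (st a (e ∷ es)) ≡ (just e , st a es)
      pop-cons a e es = trans (cong (popped i (st a (e ∷ es))) (lookup-st a (e ∷ es)))
                              (cong (just e ,_) (update-st a (e ∷ es) es))

    -- `st` describes all stacks in terms of an accumulator and the unread part of stack `i`, so a
    -- loop is reasoned about as a `foldl` of the pure function `nxt`. Each element costs a pop, the
    -- body and a `ret`.
    forEach-run : ∀ xs q a → let (q′ , a′) = foldl nxt (q , a) xs in
      Run (forEach i body q) (st a xs) q′ (st a′ []) (2 + length xs * (2 + c))
    forEach-run []       q a = done (bind (act (pop-nil a)) ret)
    forEach-run (e ∷ es) q a = slack (≤-reflexive lemma)
      (again (bind (act (pop-cons a e es)) (bind (body-run q a e es) ret)) (forEach-run es _ _))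
      where
      lemma : 1 + (c + 1) + (2 + length es * (2 + c)) ≡ 2 + (2 + c + length es * (2 + c))
      lemma = solve 2 (λ c m → con 1 :+ (c :+ con 1) :+ (con 2 :+ m) := con 2 :+ (con 2 :+ c :+ m)) refl c (length es * (2 + c))
        where open +-*-Solver

-- Eight stacks

𝓢 : Model
𝓢 = Stacks 7

-- `#in` comes last on purpose: seven separators inserted before the input make the input letters
-- the contents of that stack, and an answer placed there is followed by blanks only, so it can be
-- read off the tape. Stacks 4 to 6 hold input strings.
pattern #tmp   = 0F
pattern #left  = 1F
pattern #right = 2F
pattern #out   = 3F
pattern #in    = 7F

clear : Fin 8 → Prog 𝓢 ⊤
clear i = forEach i (λ _ _ → ret tt) tt

transfer : Fin 8 → Fin 8 → Prog 𝓢 ⊤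
transfer i j = forEach i (λ _ e → act (push j e)) tt

bit : Bool → Elem
bit b = false , just b

mark : Elem
mark = true , just true

letters : List Str → List Elem
letters []       = []
letters (z ∷ zs) = map bit z ++ mark ∷ letters zs

start : List Str → StackState 7
start zs = [] ∷ [] ∷ [] ∷ [] ∷ [] ∷ [] ∷ [] ∷ letters zs ∷ []

-- Two output bits per letter: read cell by cell, the packed letters are the output string.
pack : Str → List Elem
pack []          = []
pack (a ∷ [])    = (a , nothing) ∷ []
pack (a ∷ b ∷ w) = (a , just b) ∷ pack w

packLoop : Prog 𝓢 ⊤
packLoop = iter (λ _ → bind (act (pop #out)) first) tt
  where
  second : Bool → Maybe Elem → Prog 𝓢 (⊤ ⊎ ⊤)
  second a nothing        = bind (act (push #tmp (a , nothing))) λ _ → ret (inj₂ tt)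
  second a (just (_ , s)) = bind (act (push #tmp (a , s))) λ _ → ret (inj₁ tt)
  first : Maybe Elem → Prog 𝓢 (⊤ ⊎ ⊤)
  first (just (_ , just a)) = bind (act (pop #out)) (second a)
  first _                   = ret (inj₂ tt)

packUp : Prog 𝓢 ⊤
packUp =
  bind (clear #tmp) λ _ →
  bind (clear #in) λ _ →
  bind packLoop λ _ →
  transfer #tmp #in

packLoop-run : ∀ w t l r zs → Run packLoop (t ∷ l ∷ r ∷ map bit w ∷ zs) tt ((pack w ʳ++ t) ∷ l ∷ r ∷ [] ∷ zs) (4 * suc (length w))
packLoop-run []          t l r zs = slack (s≤s (s≤s z≤n)) (done (bind (act refl) ret))
packLoop-run (a ∷ [])    t l r zs = slack (s≤s (s≤s (s≤s (s≤s z≤n))))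
  (done (bind (act refl) (bind (act refl) (bind (act refl) ret))))
packLoop-run (a ∷ b ∷ w) t l r zs = slack (*-monoʳ-≤ 4 (n≤1+n (suc (suc (length w)))))
  (slack (≤-reflexive (sym (*-suc 4 (suc (length w)))))
  (again (bind (act refl) (bind (act refl) (bind (act refl) ret))) (packLoop-run w ((a , just b) ∷ t) l r zs)))

transfer-run : ∀ {i j} (st : List Elem → List Elem → StackState 7) →
  (∀ a xs → lookup (st a xs) i ≡ xs) → (∀ a xs ys → st a xs [ i ]≔ ys ≡ st a ys) →
  (∀ a e es → st a es [ j ]≔ (e ∷ lookup (st a es) j) ≡ st (e ∷ a) es) →
  ∀ xs a → Run (transfer i j) (st a xs) tt (st (xs ʳ++ a) []) (2 + length xs * 3)
transfer-run {i} {j} st lookup-st update-st push-st xs a =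
  subst (λ (p : ⊤ × List Elem) → Run (transfer i j) (st a xs) (proj₁ p) (st (proj₂ p) []) (2 + length xs * 3)) (fold xs a)
  (forEach-run st (λ { (q , a) e → q , e ∷ a }) 1 lookup-st update-st
    (λ _ a e es → act (cong (tt ,_) (push-st a e es))) xs tt a)
  where
  fold : ∀ xs a → foldl (λ { (q , a) e → q , e ∷ a }) (tt , a) xs ≡ (tt , xs ʳ++ a)
  fold []       a = refl
  fold (x ∷ xs) a = fold xs (x ∷ a)

clear-run : ∀ {i} (st : List Elem → StackState 7) →
  (∀ xs → lookup (st xs) i ≡ xs) → (∀ xs ys → st xs [ i ]≔ ys ≡ st ys) →
  ∀ xs → Run (clear i) (st xs) tt (st []) (2 + length xs * 3)
clear-run {i} st lookup-st update-st xs =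
  forEach-run {Acc = ⊤} (λ _ → st) (λ s _ → s) 1
    (λ _ → lookup-st) (λ _ → update-st) (λ _ _ _ _ → ret) xs tt tt

length-pack : ∀ w → length (pack w) ≤ length w
length-pack []          = z≤n
length-pack (_ ∷ [])    = ≤-refl
length-pack (_ ∷ _ ∷ w) = s≤s (m≤n⇒m≤1+n (length-pack w))

packUp-run : ∀ w t l r a b c i →
  Run packUp (t ∷ l ∷ r ∷ map bit w ∷ a ∷ b ∷ c ∷ i ∷ []) tt
      ([] ∷ l ∷ r ∷ [] ∷ a ∷ b ∷ c ∷ pack w ∷ []) (10 * suc (length t + (length i + length w)))
packUp-run w t l r a b c i = slack cost (bind
  (clear-run (λ xs → xs ∷ l ∷ r ∷ map bit w ∷ a ∷ b ∷ c ∷ i ∷ []) (λ _ → refl) (λ _ _ → refl) t)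
  (bind
  (clear-run (λ xs → [] ∷ l ∷ r ∷ map bit w ∷ a ∷ b ∷ c ∷ xs ∷ []) (λ _ → refl) (λ _ _ → refl) i)
  (bind (packLoop-run w [] l r (a ∷ b ∷ c ∷ [] ∷ []))
  (subst₂ (λ xs n → Run (transfer #tmp #in) (reverse (pack w) ∷ l ∷ r ∷ [] ∷ a ∷ b ∷ c ∷ [] ∷ []) tt
      ([] ∷ l ∷ r ∷ [] ∷ a ∷ b ∷ c ∷ xs ∷ []) (2 + n * 3))
    (trans (ʳ++-ʳ++ (pack w)) (++-identityʳ (pack w))) (trans (length-ʳ++ (pack w)) (+-identityʳ _))
    (transfer-run (λ acc xs → xs ∷ l ∷ r ∷ [] ∷ a ∷ b ∷ c ∷ acc ∷ [])
      (λ _ _ → refl) (λ _ _ _ → refl) (λ _ _ _ → refl) (reverse (pack w)) [])))))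
  where
  cost : 2 + length t * 3 + (2 + length i * 3 + (4 * suc (length w) + (2 + length (pack w) * 3)))
         ≤ 10 * suc (length t + (length i + length w))
  cost = ≤-trans (+-monoʳ-≤ (2 + length t * 3) (+-monoʳ-≤ (2 + length i * 3) (+-monoʳ-≤ (4 * suc (length w))
      (+-monoʳ-≤ 2 (*-monoˡ-≤ 3 (length-pack w))))))
    (≤-trans (m≤m+n _ (length t * 7 + length i * 7 + length w * 3)) (≤-reflexive
      (solve 3 (λ t i w → con 2 :+ t :* con 3 :+ (con 2 :+ i :* con 3 :+ (con 4 :* (con 1 :+ w) :+ (con 2 :+ w :* con 3)))
          :+ (t :* con 7 :+ i :* con 7 :+ w :* con 3) := con 10 :* (con 1 :+ (t :+ (i :+ w)))) refl
        (length t) (length i) (length w))))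
    where open +-*-Solver

-- Polynomial-time functions from stack programs

addSep : Prog Letters ⊤
addSep = bind (act (λ g → g , R , tt)) λ _ → bind (insert sep) λ _ → goHome

seps : ℕ → Prog Letters ⊤
seps zero    = ret tt
seps (suc n) = bind addSep λ _ → seps n

setup : ℕ → Prog Letters ⊤
setup n = bind (bind (insert home) λ _ → goHome) λ _ → seps n

pad : ℕ → List (Maybe Elem) → List (Maybe Elem)
pad zero    ws = ws
pad (suc n) ws = pad n (nothing ∷ ws)

sepsTime : ℕ → ℕ → ℕ
sepsTime n w = suc (n * (5 + 2 * (w + n)))

addSep-run : ∀ ws → Run addSep ([] , home ∷ map cell ws) tt ([] , ends (nothing ∷ ws) (blank ∷ []))
  (1 + (suc (length ws) + (2 + suc (length ws))))
addSep-run ws = bind (act refl) (insertHome-run [] nothing ws)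

seps-run : ∀ n ws r → _≃_ blank (home ∷ map cell ws) r → Σ (List Letter) λ r′ →
  _≃_ blank (home ∷ map cell (pad n ws)) r′ × Run (seps n) ([] , r) tt ([] , r′) (sepsTime n (length ws))
seps-run zero    ws r e = r , e , ret
seps-run (suc n) ws r e with run-≃ blank (addSep-run ws) e
... | r₁ , e₁ , π₁ with seps-run n (nothing ∷ ws) r₁ (λ i → trans (drop-blank (nothing ∷ ws) i) (e₁ i))
...   | r₂ , e₂ , π₂ = r₂ , e₂ , slack cost (bind π₁ π₂)
  where
  w = length ws
  cost : 1 + (suc w + (2 + suc w)) + sepsTime n (suc w) ≤ sepsTime (suc n) w
  cost = ≤-trans (m≤m+n _ (2 * suc n)) (≤-reflexive
    (solve 2 (λ n w → con 1 :+ (con 1 :+ w :+ (con 2 :+ (con 1 :+ w))) :+ (con 1 :+ n :* (con 5 :+ con 2 :* (con 1 :+ w :+ n))) :+ con 2 :* (con 1 :+ n)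
        := con 1 :+ (con 1 :+ n) :* (con 5 :+ con 2 :* (w :+ (con 1 :+ n)))) refl n w))
    where open +-*-Solver

setupTime : ℕ → ℕ → ℕ
setupTime n w = suc w + (2 + w) + sepsTime n w

setup-run : ∀ n ws → Σ (List Letter) λ r → _≃_ blank (home ∷ map cell (pad n ws)) r ×
  Run (setup n) ([] , map cell ws) tt ([] , r) (setupTime n (length ws))
setup-run n ws with seps-run n ws (ends ws (blank ∷ [])) (drop-blank ws)
... | r , e , π = r , e , bind (bind (insert-run home [] ws) (goHome-run ws [] refl)) π

spread-≃ : ∀ r r′ → _≃_ blank r r′ → _≃_ nothing (spread r) (spread r′)
spread-≃ [] [] e n = refl
spread-≃ [] (g ∷ r′) e zero rewrite sym (e 0) = refl
spread-≃ [] (g ∷ r′) e (suc zero) rewrite sym (e 0) = refl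
spread-≃ [] (g ∷ r′) e (suc (suc n)) = spread-≃ [] r′ (λ i → e (suc i)) n
spread-≃ (g ∷ r) [] e zero rewrite e 0 = refl
spread-≃ (g ∷ r) [] e (suc zero) rewrite e 0 = refl
spread-≃ (g ∷ r) [] e (suc (suc n)) = spread-≃ r [] (λ i → e (suc i)) n
spread-≃ (g ∷ r) (g′ ∷ r′) e zero rewrite e 0 = refl
spread-≃ (g ∷ r) (g′ ∷ r′) e (suc zero) rewrite e 0 = refl
spread-≃ (g ∷ r) (g′ ∷ r′) e (suc (suc n)) = spread-≃ r r′ (λ i → e (suc i)) n

readOut-≃ : ∀ r r′ → _≃_ nothing r r′ → readOut r ≡ readOut r′
readOut-≃ [] [] e = refl
readOut-≃ [] (nothing ∷ r′) e = refl
readOut-≃ [] (just _ ∷ r′) e with () ← e 0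
readOut-≃ (nothing ∷ r) [] e = refl
readOut-≃ (just _ ∷ r) [] e with () ← e 0
readOut-≃ (s ∷ r) (s′ ∷ r′) e with refl ← e 0 with s
... | nothing = refl
... | just b  = cong (b ∷_) (readOut-≃ r r′ (λ i → e (suc i)))

readOut-pack : ∀ w → readOut (spread (map cell (map just (pack w)))) ≡ w
readOut-pack []          = refl
readOut-pack (a ∷ [])    = refl
readOut-pack (a ∷ b ∷ w) = cong (λ w → a ∷ b ∷ w) (readOut-pack w)

spread-letters : ∀ zs → spread (map cell (map just (letters zs))) ≡ map just (encodeList zs)
spread-letters [] = refl
spread-letters (z ∷ zs) = go z
  where
  go : ∀ w → spread (map cell (map just (map bit w ++ mark ∷ letters zs)))
             ≡ map just (encBits w ++ true ∷ true ∷ encodeList zs)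
  go []          = cong (λ r → just true ∷ just true ∷ r) (spread-letters zs)
  go (false ∷ w) = cong (λ r → just false ∷ just false ∷ r) (go w)
  go (true ∷ w)  = cong (λ r → just false ∷ just true ∷ r) (go w)

length-letters : ∀ zs → length (letters zs) ≤ length (encodeList zs)
length-letters [] = z≤n
length-letters (z ∷ zs) = go z
  where
  go : ∀ w → length (map bit w ++ mark ∷ letters zs) ≤ length (encBits w ++ true ∷ true ∷ encodeList zs)
  go []          = s≤s (m≤n⇒m≤1+n (length-letters zs))
  go (false ∷ w) = s≤s (m≤n⇒m≤1+n (go w))
  go (true ∷ w)  = s≤s (m≤n⇒m≤1+n (go w))

lookup-size : ∀ {k} j (s : StackState k) → length (lookup s j) ≤ size s
lookup-size j s rewrite flat-lookup j s | length-++ (before j s) {map just (lookup s j) ++ after j s}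
  | length-++ (map just (lookup s j)) {after j s} | length-map (just {A = Elem}) (lookup s j) =
  ≤-trans (m≤m+n _ _) (m≤n+m _ (length (before j s)))

before-size : ∀ {k} j (s : StackState k) → length (before j s) ≤ size s
before-size j s rewrite flat-lookup j s | length-++ (before j s) {map just (lookup s j) ++ after j s} = m≤m+n _ _

packedTime : ℕ → ℕ → ℕ
packedTime T z = T + 10 * suc ((z + T) + ((z + T) + (z + T)))

packed-run : ∀ {p : Prog 𝓢 ⊤} {s s′ T w} → Run p s tt s′ T → lookup s′ #out ≡ map bit w →
  Σ (StackState 6) λ q → Run (bind p λ _ → packUp) s tt (q ∷ʳ pack w) (packedTime T (size s))
packed-run {s = s} {s′@(t ∷ l ∷ r ∷ .(map bit w) ∷ a ∷ b ∷ c ∷ i ∷ [])} {T} {w} π refl =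
  [] ∷ l ∷ r ∷ [] ∷ a ∷ b ∷ c ∷ [] ,
  bind π (slack (*-monoʳ-≤ 10 (s≤s (+-mono-≤ (≤-trans (lookup-size #tmp s′) grown) (+-mono-≤
      (≤-trans (lookup-size #in s′) grown)
      (≤-trans (≤-trans (≤-reflexive (sym (length-map bit w))) (lookup-size #out s′)) grown)))))
    (packUp-run w t l r a b c i))
  where
  grown : size s′ ≤ size s + T
  grown = size-run size size-act π

last-run : ∀ (q : StackState 6) xs → Σ (List Letter) λ l →
  Run (goStack 7) ([] , home ∷ map cell (flat (q ∷ʳ xs))) tt (l , map cell (map just xs))
      (2 + size (q ∷ʳ xs))
last-run q@(a ∷ b ∷ c ∷ d ∷ e ∷ f ∷ g ∷ []) xs = _ ,
  slack (+-monoʳ-≤ 2 (before-size #in (q ∷ʳ xs)))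
    (subst₂ (λ u v → Run (goStack 7) ([] , home ∷ map cell u) tt
               (map cell (before #in (q ∷ʳ xs)) ʳ++ home ∷ [] , map cell v) (2 + length (before #in (q ∷ʳ xs))))
      (sym (flat-lookup #in (q ∷ʳ xs))) (++-identityʳ (map just xs))
      (goStack-run #in (q ∷ʳ xs) (map just xs ++ [])))

last-layout : ∀ (q : StackState 6) xs {t} → Layout (q ∷ʳ xs) t →
  Σ (Tape Letter) λ t′ → _≃_ blank (map cell (map just xs)) (proj₂ t′) ×
    Run (goStack 7) t tt t′ (2 + size (q ∷ʳ xs))
last-layout q xs {.[] , r} (refl , e) =
  let (_ , π) = last-run q xs
      (_ , e′ , π′) = run-≃ blank π e
  in _ , e′ , π′

setupTime-mono : ∀ k {m n} → m ≤ n → setupTime k m ≤ setupTime k n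
setupTime-mono k m≤n = +-mono-≤ (+-mono-≤ (s≤s m≤n) (+-monoʳ-≤ 2 m≤n))
  (s≤s (*-monoʳ-≤ k (+-monoʳ-≤ 5 (*-monoʳ-≤ 2 (+-monoˡ-≤ k m≤n)))))

packedTime-mono : ∀ T {y z} → y ≤ z → packedTime T y ≤ packedTime T z
packedTime-mono T y≤z = +-monoʳ-≤ T (*-monoʳ-≤ 10 (s≤s (+-mono-≤ h (+-mono-≤ h h))))
  where h = +-monoˡ-≤ T y≤z

size-start : ∀ zs → size (start zs) ≡ 7 + length (letters zs)
size-start zs = cong (7 +_) (length-map just (letters zs))

module _ (p : Prog Letters ⊤) where

  private
    module LC = Simulation letterSim

    cellTime-poly : ∀ {f} → Poly f → Poly (λ n → LC.time (f n) 0)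
    cellTime-poly pf = poly-* pf (poly-* (poly-const 7) (poly-suc pf))

    open Compile (LC.translate p) (Maybe-finite {{States-finite (LC.translate p)}})

    output-run : ∀ zs w {u T} → _≃_ blank (map cell (map just (pack w))) (proj₂ u) →
      Run p ([] , map cell (map just (letters zs))) tt u T → ∀ {n} → LC.time T 0 ≤ n →
      Maybe.map output (exec toTM n (initial toTM (encodeList zs))) ≡ just w
    output-run zs w {u} {T} e π ≤n with LC.translate-run π refl
    ... | _ , refl , π₁ = trans
      (toTM-output (slack ≤n (subst (λ r → Run (LC.translate p) ([] , r) tt (spreadˡ (proj₁ u) , spread (proj₂ u)) (LC.time T 0))
        (spread-letters zs) π₁)))
      (cong just (trans (readOut-≃ (spread (proj₂ u)) (spread (map cell (map just (pack w))))
          (λ n → sym (spread-≃ (map cell (map just (pack w))) (proj₂ u) e n)))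
        (readOut-pack w)))

  letter-computes : {X : Set} (list : X → List Str) (g : X → Str) {t : ℕ → ℕ} → Poly t →
    (∀ x → Σ (Tape Letter) λ u → _≃_ blank (map cell (map just (pack (g x)))) (proj₂ u) ×
             Run p ([] , map cell (map just (letters (list x)))) tt u (t (length (encodeList (list x))))) →
    PolyTimeOn (λ x → encodeList (list x)) g
  letter-computes list g pt runs =
    let (c , k , bound) = poly-bound (cellTime-poly pt)
    in toTM , c , k , λ x → let (u , e , π) = runs x in
         output-run (list x) (g x) e π (bound (length (encodeList (list x))))

module _ (p : Prog 𝓢 ⊤) where

  private
    module SL = Simulation (stackSim 7)

  letterProg : Prog Letters ⊤
  letterProg = bind (setup 7) λ _ → bind (SL.translate (bind p λ _ → packUp)) λ _ → goStack 7

  letterTime : ℕ → ℕ → ℕ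
  letterTime T n = setupTime 7 n + (SL.time (packedTime T (7 + n)) (7 + n) + (2 + (7 + n + packedTime T (7 + n))))

  letterProg-run : ∀ {zs s′ T w n} → Run p (start zs) tt s′ T → lookup s′ #out ≡ map bit w →
    length (letters zs) ≤ n →
    Σ (Tape Letter) λ t → _≃_ blank (map cell (map just (pack w))) (proj₂ t) ×
      Run letterProg ([] , map cell (map just (letters zs))) tt t (letterTime T n)
  letterProg-run {zs} {T = T} {w} {n} π out ≤n =
    let (q , π₁)     = packed-run π out
        (r , e , π₀) = setup-run 7 (map just (letters zs))
        (t , e₁ , π₂) = SL.translate-run {t = [] , r} π₁ (refl , e)
        (t′ , e₂ , π₃) = last-layout q (pack w) e₁
    in t′ , e₂ , bind
         (slack (setupTime-mono 7 (≤-trans (≤-reflexive (length-map just (letters zs))) ≤n)) π₀) (bind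
         (slack (SL.time-mono (packedTime-mono T z≤) z≤) π₂)
         (slack (+-monoʳ-≤ 2 (≤-trans (size-run size size-act π₁) (+-mono-≤ z≤ (packedTime-mono T z≤)))) π₃))
    where
    z≤ : size (start zs) ≤ 7 + n
    z≤ = ≤-trans (≤-reflexive (size-start zs)) (+-monoʳ-≤ 7 ≤n)

  letterTime-poly : ∀ {t} → Poly t → Poly (λ n → letterTime (t n) n)
  letterTime-poly {t} pt = poly-+
    (poly-+ (poly-+ (poly-suc poly-id) (poly-+ (poly-const 2) poly-id))
      (poly-suc (poly-* (poly-const 7) (poly-+ (poly-const 5) (poly-* (poly-const 2) (poly-+ poly-id (poly-const 7)))))))
    (poly-+ (poly-* packed (poly-* (poly-const 10) (poly-suc (poly-+ 7+n packed))))
      (poly-+ (poly-const 2) (poly-+ 7+n packed)))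
    where
    7+n : Poly (7 +_)
    7+n = poly-+ (poly-const 7) poly-id
    z+T : Poly (λ n → 7 + n + t n)
    z+T = poly-+ 7+n pt
    packed : Poly (λ n → packedTime (t n) (7 + n))
    packed = poly-+ pt (poly-* (poly-const 10) (poly-suc (poly-+ z+T (poly-+ z+T z+T))))

  -- The only interface to Turing machines used for the two concrete functions `mc` and `least`: it
  -- suffices to leave the answer on `#out` after polynomially many stack actions.
  computes : {X : Set} (list : X → List Str) (g : X → Str) {t : ℕ → ℕ} → Poly t →
    (∀ x → Σ (StackState 7) λ s → Run p (start (list x)) tt s (t (length (encodeList (list x)))) ×
                                  lookup s #out ≡ map bit (g x)) →
    PolyTimeOn (λ x → encodeList (list x)) g
  computes list g {t} pt runs = letter-computes letterProg list g (letterTime-poly pt) λ x →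
    let (s , π , out) = runs x in letterProg-run {list x} π out (length-letters (list x))

-- Simulating a Turing machine on two stacks

sy : Sym → Elem
sy s = false , s

symOf : Maybe Elem → Sym
symOf nothing        = nothing
symOf (just (_ , s)) = s

push? : Maybe Elem → Prog 𝓢 ⊤
push? nothing  = ret tt
push? (just e) = act (push #right e)

-- The scanned symbol has been popped beforehand and `g` replaces it. With `#left` empty, a left
-- move pushes nothing further and the head stays, in accordance with `move`.
moveCode : Move → Sym → Prog 𝓢 ⊤
moveCode L g = bind (act (push #right (sy g))) λ _ → bind (act (pop #left)) push?
moveCode R g = act (push #left (sy g))
moveCode S g = act (push #right (sy g))

module _ (M : TM) where

  respond : Sym → Maybe (Fin (TM.nQ M) × Sym × Move) → Prog 𝓢 (Fin (TM.nQ M) ⊎ ⊤)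
  respond h nothing             = bind (act (push #right (sy h))) λ _ → ret (inj₂ tt)
  respond h (just (q , g , m)) = bind (moveCode m g) λ _ → ret (inj₁ q)

  simulate : Fin (TM.nQ M) → Prog 𝓢 ⊤
  simulate = iter λ q → bind (act (pop #right)) λ e → respond (symOf e) (TM.δ M q (symOf e))

length-shift : ∀ m l (g : Sym) r → let (l′ , r′) = shift nothing m (l , g ∷ r) in
  length l′ + length r′ ≡ suc (length l + length r)
length-shift L []      g r = refl
length-shift L (_ ∷ l) g r = trans (+-suc (length l) _) (cong suc (+-suc (length l) _))
length-shift R l       g r = refl
length-shift S l       g r = +-suc (length l) (length r)

tl-≤ : ∀ (r : List Sym) → length (tl nothing r) ≤ length r
tl-≤ []      = z≤n
tl-≤ (_ ∷ r) = n≤1+n _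

module _ {t o : List Elem} {zs : Vec (List Elem) 4} where

  tape : List Sym → List Sym → StackState 7
  tape l r = t ∷ map sy l ∷ map sy r ∷ o ∷ zs

  moveCode-run : ∀ m g l r → let (l′ , r′) = shift nothing m (l , g ∷ r) in
    Run (moveCode m g) (tape l r) tt (tape l′ r′) 3
  moveCode-run L g []      r = bind (act refl) (bind (act refl) ret)
  moveCode-run L g (_ ∷ _) r = bind (act refl) (bind (act refl) (act refl))
  moveCode-run R g l       r = slack (s≤s z≤n) (act refl)
  moveCode-run S g l       r = slack (s≤s z≤n) (act refl)

  pop-run : ∀ {X} (K : Sym → Prog 𝓢 X) l r {x s n} → Run (K (hd nothing r)) (tape l (tl nothing r)) x s n →
    Run (bind (act (pop #right)) λ e → K (symOf e)) (tape l r) x s (suc n)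
  pop-run K l []      π = bind (act refl) π
  pop-run K l (_ ∷ _) π = bind (act refl) π

  -- The length bound later pays for clearing both stacks. The tape grows by at most one cell per
  -- step, and by one more when the machine halts on a blank beyond the end, which is pushed back.
  simulate-run : ∀ M n q l r {c} → exec M n (config q (view (l , r))) ≡ just c →
    Σ (List Sym) λ l′ → Σ (List Sym) λ r′ →
      Run (simulate M q) (tape l r) tt (tape l′ r′) (suc n * 5) × output c ≡ readOut r′ ×
      length l′ + length r′ ≤ suc (length l + length r + n)
  simulate-run M n q l r ex with TM.δ M q (hd nothing r) in δ≡
  ... | nothing
    with refl ← ex =
    l , hd nothing r ∷ tl nothing r ,
    slack (s≤s (s≤s (s≤s z≤n)))
      (done (pop-run (λ h → respond M h (TM.δ M q h)) l r
        (subst (λ d → Run (respond M (hd nothing r) d) (tape l (tl nothing r)) (inj₂ tt)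
                          (tape l (hd nothing r ∷ tl nothing r)) 2) (sym δ≡)
          (bind (act refl) ret)))) ,
    refl ,
    ≤-trans (≤-reflexive (+-suc (length l) _)) (s≤s (≤-trans (+-monoʳ-≤ (length l) (tl-≤ r)) (m≤m+n _ n)))
  simulate-run M zero q l r () | just _
  simulate-run M (suc n) q l r ex | just (q′ , g , m)
    with shift nothing m (l , g ∷ tl nothing r) | view-shift m l g (tl nothing r)
       | moveCode-run m g l (tl nothing r) | length-shift m l g (tl nothing r)
  ... | l₁ , r₁ | v≡ | π₁ | len₁
    with simulate-run M n q′ l₁ r₁ (trans (cong (λ v → exec M n (config q′ v)) v≡)
           ex)
  ... | l′ , r′ , π′ , out , len =
    l′ , r′ ,
    again (pop-run (λ h → respond M h (TM.δ M q h)) l r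
      (subst (λ d → Run (respond M (hd nothing r) d) (tape l (tl nothing r)) (inj₁ q′) (tape l₁ r₁) 4) (sym δ≡)
        (bind π₁ ret))) π′ ,
    out ,
    ≤-trans len (s≤s (≤-trans (+-monoˡ-≤ n (≤-trans (≤-reflexive len₁)
        (s≤s (+-monoʳ-≤ (length l) (tl-≤ r))))) (≤-reflexive (sym (+-suc (length l + length r) n)))))

-- Comparing two input strings by a selector

#z : Fin 4 → Fin 8
#z i = suc (suc (suc (suc i)))

-- Stored strings have their last bit on top, so pushing each popped bit and then a 0 leaves
-- `encBits` of the string on `#right` in reading order. `#tmp` keeps a copy for restoring the
-- stack.
copyLoop : Fin 4 → Prog 𝓢 ⊤
copyLoop i = forEach (#z i) (λ _ e →
  bind (act (push #tmp e)) λ _ → bind (act (push #right e)) λ _ → act (push #right (bit false))) tt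

copyIn : Fin 4 → Prog 𝓢 ⊤
copyIn i =
  bind (act (push #right (bit true))) λ _ →
  bind (act (push #right (bit true))) λ _ →
  bind (copyLoop i) λ _ →
  transfer #tmp (#z i)

same : Bool → Bool → Bool
same true  b = b
same false b = not b

sameSym : Sym → Sym → Bool
sameSym (just a) (just b) = same a b
sameSym _        _        = false

isBlank : Sym → Bool
isBlank nothing  = true
isBlank (just _) = false

check : Fin 4 → Bool → Prog 𝓢 Bool
check i = iter λ q → bind (act (pop #tmp)) (turn q)
  where
  turn : Bool → Maybe Elem → Prog 𝓢 (Bool ⊎ Bool)
  turn q nothing  = bind (act (pop #right)) λ m → ret (inj₂ (q ∧ isBlank (symOf m)))
  turn q (just e) = bind (act (push (#z i) e)) λ _ →
    bind (act (pop #right)) λ m → ret (inj₁ (q ∧ sameSym (proj₂ e) (symOf m)))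

verdict : Fin 4 → Prog 𝓢 Bool
verdict i =
  bind (transfer (#z i) #tmp) λ _ →
  bind (check i true) λ b →
  bind (clear #left) λ _ →
  bind (clear #right) λ _ →
  ret b

-- String `j` is copied first so that string `i` ends on top, as the first component of the pair.
-- All three work stacks are empty again afterwards, ready for the next comparison.
cmpProg : TM → Fin 4 → Fin 4 → Prog 𝓢 Bool
cmpProg M i j =
  bind (copyIn j) λ _ →
  bind (copyIn i) λ _ →
  bind (simulate M (TM.start M)) λ _ →
  verdict i

eqStr : Str → Str → Bool
eqStr []      []      = true
eqStr (a ∷ x) (b ∷ y) = same b a ∧ eqStr x y
eqStr _       _       = false

eqStr-sound : ∀ x y → eqStr x y ≡ true → x ≡ y
eqStr-sound []          []          _ = refl
eqStr-sound (true ∷ x)  (true ∷ y)  e = cong (true ∷_) (eqStr-sound x y e)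
eqStr-sound (false ∷ x) (false ∷ y) e = cong (false ∷_) (eqStr-sound x y e)

eqStr-refl : ∀ x → eqStr x x ≡ true
eqStr-refl []          = refl
eqStr-refl (true ∷ x)  = eqStr-refl x
eqStr-refl (false ∷ x) = eqStr-refl x

match : Bool → Str → List Sym → Bool
match q []      r = q ∧ isBlank (hd nothing r)
match q (a ∷ z) r = match (q ∧ sameSym (just a) (hd nothing r)) z (tl nothing r)

unread : Str → List Sym → List Sym
unread []      r = tl nothing r
unread (_ ∷ z) r = unread z (tl nothing r)

length-unread : ∀ z r → length (unread z r) ≤ length r
length-unread []      r = tl-≤ r
length-unread (_ ∷ z) r = ≤-trans (length-unread z (tl nothing r)) (tl-≤ r)

match-false : ∀ z r → match false z r ≡ false
match-false []      r = refl
match-false (_ ∷ z) r = match-false z (tl nothing r)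

-- A blank or a wrong bit makes the flag false for good, so popping on behind the end of the output
-- cannot revive it; the final blank test rejects outputs that are too long.
match-readOut : ∀ z r → match true z r ≡ eqStr (readOut r) z
match-readOut []      []            = refl
match-readOut []      (nothing ∷ r) = refl
match-readOut []      (just _ ∷ r)  = refl
match-readOut (_ ∷ z) []            = match-false z []
match-readOut (_ ∷ z) (nothing ∷ r) = match-false z r
match-readOut (a ∷ z) (just b ∷ r) with same a b
... | true  = match-readOut z r
... | false = match-false z r

verdictTime : ℕ → ℕ → ℕ
verdictTime n m = 2 + n * 3 + (3 + n * 4 + (2 + m * 3 + (2 + m * 3 + 1)))

cmpTime : ℕ → ℕ → ℕ
cmpTime n N = 8 * suc n + (8 * suc n + (suc N * 5 + verdictTime n (suc (n + N))))

module _ {o : List Elem} where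

  check-run : ∀ i (zs : Vec (List Elem) 4) l z acc r q →
    Run (check i q) (map bit z ∷ map sy l ∷ map sy r ∷ o ∷ zs [ i ]≔ acc) (match q z r)
        ([] ∷ map sy l ∷ map sy (unread z r) ∷ o ∷ zs [ i ]≔ (map bit z ʳ++ acc)) (3 + length z * 4)
  check-run i zs l [] acc r q =
    done (bind (act refl) (pop-run (λ h → ret (inj₂ (q ∧ isBlank h))) l r ret))
  check-run i zs l (a ∷ z) acc r q = again (bind (act refl) (bind
        (act (cong (λ v → tt , map bit z ∷ map sy l ∷ map sy r ∷ o ∷ v)
          (trans ([]≔-idempotent zs i) (cong (λ xs → zs [ i ]≔ (bit a ∷ xs)) (lookup∘update i zs acc)))))
        (pop-run (λ h → ret (inj₁ (q ∧ sameSym (just a) h))) l r ret)))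
      (check-run i zs l z (bit a ∷ acc) (tl nothing r) _)

  copyLoop-run : ∀ i (zs : Vec (List Elem) 4) l z w →
    Run (copyLoop i) ([] ∷ l ∷ map bit (true ∷ true ∷ w) ∷ o ∷ zs [ i ]≔ reverse (map bit z)) tt
        (map bit z ∷ l ∷ map bit (encBits z ++ true ∷ true ∷ w) ∷ o ∷ zs [ i ]≔ []) (2 + length z * 5)
  copyLoop-run i zs l z w = subst₂
    (λ (s : ⊤ × List Elem × List Elem) n →
      Run (copyLoop i) (st ([] , map bit (true ∷ true ∷ w)) (reverse (map bit z))) (proj₁ s) (st (proj₂ s) []) (2 + n * 5))
    (trans (reverse-foldl nxt (tt , [] , map bit (true ∷ true ∷ w)) (map bit z)) (fold z))
    (trans (trans (length-ʳ++ (map bit z)) (+-identityʳ _)) (length-map bit z))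
    (forEach-run st nxt 3 (λ _ xs → lookup∘update i zs xs) (λ a _ _ → cong (λ v → proj₁ a ∷ l ∷ proj₂ a ∷ o ∷ v) ([]≔-idempotent zs i))
      (λ _ _ _ _ → bind (act refl) (bind (act refl) (act refl)))
      (reverse (map bit z)) tt ([] , map bit (true ∷ true ∷ w)))
    where
    st : List Elem × List Elem → List Elem → StackState 7
    st (t , r) xs = t ∷ l ∷ r ∷ o ∷ zs [ i ]≔ xs
    nxt : ⊤ × List Elem × List Elem → Elem → ⊤ × List Elem × List Elem
    nxt (q , t , r) e = q , e ∷ t , bit false ∷ e ∷ r
    fold : ∀ z → foldr (flip nxt) (tt , [] , map bit (true ∷ true ∷ w)) (map bit z) ≡
                 (tt , map bit z , map bit (encBits z ++ true ∷ true ∷ w))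
    fold []          = refl
    fold (false ∷ z) = cong (λ s → nxt s (bit false)) (fold z)
    fold (true ∷ z)  = cong (λ s → nxt s (bit true)) (fold z)

  copyIn-run : ∀ i (zs : Vec (List Elem) 4) l z w → lookup zs i ≡ reverse (map bit z) →
    Run (copyIn i) ([] ∷ l ∷ map bit w ∷ o ∷ zs) tt
        ([] ∷ l ∷ map bit (encBits z ++ true ∷ true ∷ w) ∷ o ∷ zs) (8 * suc (length z))
  copyIn-run i zs l z w z≡ = slack cost (bind (act refl) (bind (act refl) (bind
    (subst (λ v → Run (copyLoop i) ([] ∷ l ∷ map bit (true ∷ true ∷ w) ∷ o ∷ v) tt
        (map bit z ∷ l ∷ map bit (encBits z ++ true ∷ true ∷ w) ∷ o ∷ zs [ i ]≔ []) (2 + length z * 5))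
      restored (copyLoop-run i zs l z w))
    (subst (λ v → Run (transfer #tmp (#z i)) (map bit z ∷ l ∷ map bit (encBits z ++ true ∷ true ∷ w) ∷ o ∷ zs [ i ]≔ []) tt
        ([] ∷ l ∷ map bit (encBits z ++ true ∷ true ∷ w) ∷ o ∷ v) (2 + length (map bit z) * 3))
      restored
      (transfer-run (λ acc xs → xs ∷ l ∷ map bit (encBits z ++ true ∷ true ∷ w) ∷ o ∷ zs [ i ]≔ acc)
        (λ _ _ → refl) (λ _ _ _ → refl)
        (λ a e es → cong (λ v → es ∷ l ∷ map bit (encBits z ++ true ∷ true ∷ w) ∷ o ∷ v)
          (trans ([]≔-idempotent zs i) (cong (λ xs → zs [ i ]≔ (e ∷ xs)) (lookup∘update i zs a))))
        (map bit z) [])))))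
    where
    restored : zs [ i ]≔ reverse (map bit z) ≡ zs
    restored = trans (cong (zs [ i ]≔_) (sym z≡)) ([]≔-lookup zs i)
    cost : 1 + (1 + (2 + length z * 5 + (2 + length (map bit z) * 3))) ≤ 8 * suc (length z)
    cost rewrite length-map bit z = ≤-trans (m≤m+n _ 2) (≤-reflexive
      (solve 1 (λ z → con 1 :+ (con 1 :+ (con 2 :+ z :* con 5 :+ (con 2 :+ z :* con 3))) :+ con 2 := con 8 :* (con 1 :+ z)) refl (length z)))
      where open +-*-Solver

  verdict-run : ∀ i (zs : Vec (List Elem) 4) l r z {n m} → lookup zs i ≡ reverse (map bit z) →
    length z ≤ n → length l + length r ≤ m →
    Run (verdict i) ([] ∷ map sy l ∷ map sy r ∷ o ∷ zs) (eqStr (readOut r) z)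
        ([] ∷ [] ∷ [] ∷ o ∷ zs) (verdictTime n m)
  verdict-run i zs l r z {n} {m} z≡ |z|≤n lr≤m =
    bind (slack (+-monoʳ-≤ 2 (*-monoˡ-≤ 3 (≤-trans (≤-reflexive length-rev) |z|≤n)))
      (subst₂ (λ u v → Run (transfer (#z i) #tmp) ([] ∷ map sy l ∷ map sy r ∷ o ∷ u) tt
                         (v ∷ map sy l ∷ map sy r ∷ o ∷ zs [ i ]≔ []) (2 + length (reverse (map bit z)) * 3))
        restored (trans (ʳ++-ʳ++ (map bit z)) (++-identityʳ _))
        (transfer-run (λ acc xs → acc ∷ map sy l ∷ map sy r ∷ o ∷ zs [ i ]≔ xs)
          (λ _ xs → lookup∘update i zs xs)
          (λ a _ _ → cong (λ v → a ∷ map sy l ∷ map sy r ∷ o ∷ v) ([]≔-idempotent zs i))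
          (λ _ _ _ → refl) (reverse (map bit z)) [])))
    (bind (slack (+-monoʳ-≤ 3 (*-monoˡ-≤ 4 |z|≤n))
      (subst₂ (λ b v → Run (check i true) (map bit z ∷ map sy l ∷ map sy r ∷ o ∷ zs [ i ]≔ []) b
                         ([] ∷ map sy l ∷ map sy (unread z r) ∷ o ∷ v) (3 + length z * 4))
        (match-readOut z r) restored (check-run i zs l z [] r true)))
    (bind (slack (+-monoʳ-≤ 2 (*-monoˡ-≤ 3 (≤-trans (≤-reflexive (length-map sy l)) (≤-trans (m≤m+n _ _) lr≤m))))
      (clear-run (λ xs → [] ∷ xs ∷ map sy (unread z r) ∷ o ∷ zs) (λ _ → refl) (λ _ _ → refl) (map sy l)))
    (bind (slack (+-monoʳ-≤ 2 (*-monoˡ-≤ 3 (≤-trans (≤-reflexive (length-map sy (unread z r)))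
        (≤-trans (≤-trans (length-unread z r) (m≤n+m _ (length l))) lr≤m))))
      (clear-run (λ xs → [] ∷ [] ∷ xs ∷ o ∷ zs) (λ _ → refl) (λ _ _ → refl) (map sy (unread z r))))
    ret)))
    where
    restored : zs [ i ]≔ reverse (map bit z) ≡ zs
    restored = trans (cong (zs [ i ]≔_) (sym z≡)) ([]≔-lookup zs i)
    length-rev : length (reverse (map bit z)) ≡ length z
    length-rev = trans (trans (length-ʳ++ (map bit z)) (+-identityʳ _)) (length-map bit z)

  cmp-run : ∀ M i j (zs : Vec (List Elem) 4) x y w {n N} →
    lookup zs i ≡ reverse (map bit x) → lookup zs j ≡ reverse (map bit y) →
    length x ≤ n → length y ≤ n → length (encodePair (x , y)) ≤ n →
    Maybe.map output (exec M N (initial M (encodePair (x , y)))) ≡ just w →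
    Run (cmpProg M i j) ([] ∷ [] ∷ [] ∷ o ∷ zs) (eqStr w x) ([] ∷ [] ∷ [] ∷ o ∷ zs) (cmpTime n N)
  cmp-run M i j zs x y w {n} {N} x≡ y≡ x≤n y≤n xy≤n ex =
    let (c , ex′ , out)    = run-just (exec M N (initial M (encodePair (x , y)))) ex
        (l , r , π , out′ , len) = simulate-run {[]} {o} {zs} M N (TM.start M) [] (map just (encodePair (x , y)))
          (trans (cong (exec M N) (sym (initial-config M (encodePair (x , y))))) ex′)
    in bind (slack (*-monoʳ-≤ 8 (s≤s y≤n)) (copyIn-run j zs [] y [] y≡))
      (bind (slack (*-monoʳ-≤ 8 (s≤s x≤n)) (copyIn-run i zs [] x (encBits y ++ true ∷ true ∷ []) x≡))
      (bind (subst (λ u → Run (simulate M (TM.start M)) ([] ∷ [] ∷ u ∷ o ∷ zs) tt ([] ∷ map sy l ∷ map sy r ∷ o ∷ zs) (suc N * 5))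
              (sym (map-∘ (encodePair (x , y)))) π)
      (subst (λ w → Run (verdict i) ([] ∷ map sy l ∷ map sy r ∷ o ∷ zs) (eqStr w x) ([] ∷ [] ∷ [] ∷ o ∷ zs)
                      (verdictTime n (suc (n + N))))
        (trans (sym out′) out)
        (verdict-run i zs l r x x≡ x≤n (≤-trans len (s≤s (+-monoˡ-≤ N
          (≤-trans (≤-reflexive (length-map just (encodePair (x , y)))) xy≤n))))))))
    where
    run-just : ∀ (e : Maybe (Config (TM.nQ M))) → Maybe.map output e ≡ just w →
      Σ (Config (TM.nQ M)) λ c → e ≡ just c × output c ≡ w
    run-just (just c) refl = c , refl , refl

-- Reading the input

-- The result distinguishes a mark from the end of the input, which detects lists of fewer than
-- three strings.
readString : Fin 8 → Prog 𝓢 Bool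
readString j = iter (λ _ → bind (act (pop #in)) turn) tt
  where
  turn : Maybe Elem → Prog 𝓢 (⊤ ⊎ Bool)
  turn nothing            = ret (inj₂ false)
  turn (just (true , _))  = ret (inj₂ true)
  turn (just (false , s)) = bind (act (push j (false , s))) λ _ → ret (inj₁ tt)

module _ {j : Fin 8} (st : List Elem → List Elem → StackState 7)
         (lookup-st : ∀ a xs → lookup (st a xs) #in ≡ xs)
         (update-st : ∀ a xs ys → st a xs [ #in ]≔ ys ≡ st a ys)
         (push-st : ∀ a e es → st a es [ j ]≔ (e ∷ lookup (st a es) j) ≡ st (e ∷ a) es) where

  private
    pop-st : ∀ a e es → stackAct (pop #in) (st a (e ∷ es)) ≡ (just e , st a es)
    pop-st a e es = trans (cong (popped #in (st a (e ∷ es))) (lookup-st a (e ∷ es)))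
                          (cong (just e ,_) (update-st a (e ∷ es) es))

  readString-run : ∀ z a rest →
    Run (readString j) (st a (map bit z ++ mark ∷ rest)) true (st (map bit z ʳ++ a) rest) (2 + length z * 3)
  readString-run []      a rest = done (bind (act (pop-st a mark rest)) ret)
  readString-run (b ∷ z) a rest = again
    (bind (act (pop-st a (bit b) _)) (bind (act (cong (tt ,_) (push-st a (bit b) _))) ret))
    (readString-run z (bit b ∷ a) rest)

  readString-end : ∀ a → Run (readString j) (st a []) false (st a []) 2
  readString-end a = done (bind (act (cong (popped #in (st a [])) (lookup-st a []))) ret)

-- There is one mark per remaining string. The fillers are pushed before the three answers because
-- `#out` is read from the top.
fillers : Prog 𝓢 ⊤
fillers = forEach #in (λ _ e → fill e) tt
  where
  fill : Elem → Prog 𝓢 ⊤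
  fill (true , _)  = act (push #out (bit false))
  fill (false , _) = ret tt

fillers-run : ∀ {a b c} rest →
  Run fillers ([] ∷ [] ∷ [] ∷ [] ∷ a ∷ b ∷ c ∷ letters rest ∷ []) tt
      ([] ∷ [] ∷ [] ∷ map bit (replicate (length rest) false) ∷ a ∷ b ∷ c ∷ [] ∷ []) (2 + length (letters rest) * 3)
fillers-run {a} {b} {c} rest =
  subst (λ s → Run fillers (st [] (letters rest)) (proj₁ s) (st (proj₂ s) []) (2 + length (letters rest) * 3))
    (trans (fold rest [])
      (cong (tt ,_) (trans (count (length rest) []) (cong (map bit) (++-identityʳ _)))))
    (forEach-run st nxt 1 (λ _ _ → refl) (λ _ _ _ → refl)
      (λ { _ _ (true , _) _ → act refl ; _ _ (false , _) _ → ret }) (letters rest) tt [])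
  where
  st : List Elem → List Elem → StackState 7
  st o xs = [] ∷ [] ∷ [] ∷ o ∷ a ∷ b ∷ c ∷ xs ∷ []
  nxt : ⊤ × List Elem → Elem → ⊤ × List Elem
  nxt (q , o) (true , _)  = q , bit false ∷ o
  nxt (q , o) (false , _) = q , o
  stack : ℕ → List Elem → List Elem
  stack zero    o = o
  stack (suc n) o = stack n (bit false ∷ o)
  fold : ∀ rest o → foldl nxt (tt , o) (letters rest) ≡ (tt , stack (length rest) o)
  fold []       o = refl
  fold (z ∷ zs) o = go z
    where
    go : ∀ z → foldl nxt (tt , o) (map bit z ++ mark ∷ letters zs) ≡ (tt , stack (length zs) (bit false ∷ o))
    go []      = fold zs (bit false ∷ o)
    go (_ ∷ z) = go z
  count : ∀ n o → stack n (map bit o) ≡ map bit (replicate n false ++ o)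
  count zero    o = refl
  count (suc n) o = trans (count n (false ∷ o)) (cong (map bit) (shunt n o))
    where
    shunt : ∀ n (o : Str) → replicate n false ++ false ∷ o ≡ false ∷ replicate n false ++ o
    shunt zero    o = refl
    shunt (suc n) o = cong (false ∷_) (shunt n o)

-- Excluding a characteristic vector of three strings

-- extreme false is the only vertex that may lack an incoming edge, extreme true the only one
-- that may lack an outgoing edge.

candidate : Bool → Bool → Fin 3
candidate pol a = if a xor pol then 1F else 0F

survivor : Bool → Fin 3 → Bool → Fin 3
survivor pol i b = if b xor pol then 2F else i

extreme : Bool → (Fin 3 → Fin 3 → Bool) → Fin 3
extreme pol c = let i = candidate pol (c 0F 1F) in survivor pol i (c i 2F)

third : Fin 3 → Fin 3 → Fin 3
third 0F 0F = 1F
third 0F 1F = 2F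
third 0F 2F = 1F
third 1F 0F = 2F
third 1F 1F = 0F
third 1F 2F = 0F
third 2F 0F = 1F
third 2F 1F = 0F
third 2F 2F = 0F

third≢ˡ : ∀ u v → third u v ≢ u
third≢ˡ 0F 0F ()
third≢ˡ 0F 1F ()
third≢ˡ 0F 2F ()
third≢ˡ 1F 0F ()
third≢ˡ 1F 1F ()
third≢ˡ 1F 2F ()
third≢ˡ 2F 0F ()
third≢ˡ 2F 1F ()
third≢ˡ 2F 2F ()

third≢ʳ : ∀ u v → third u v ≢ v
third≢ʳ 0F 0F ()
third≢ʳ 0F 1F ()
third≢ʳ 0F 2F ()
third≢ʳ 1F 0F ()
third≢ʳ 1F 1F ()
third≢ʳ 1F 2F ()
third≢ʳ 2F 0F ()
third≢ʳ 2F 1F ()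
third≢ʳ 2F 2F ()

answer : Bool → Fin 3 → Fin 3 → Bool
answer pol y i = if does (i Fin.≟ y) then pol else not pol

triple : Str → Str → Str → Fin 3 → Str
triple x y z 0F = x
triple x y z 1F = y
triple x y z 2F = z

prefers : (Str → Str → Str) → (Fin 3 → Str) → Fin 3 → Fin 3 → Bool
prefers f z i j = eqStr (f (z i) (z j)) (z i)

-- Being wrong on the first three strings already makes the whole vector wrong, so the remaining
-- answers are constant.
mc : Bool → (f g : Str → Str → Str) → List Str → Str
mc pol f g (x ∷ y ∷ z ∷ rest) =
  let w = third (extreme pol (prefers f (triple x y z))) (extreme pol (prefers g (triple x y z)))
  in answer pol w 0F ∷ answer pol w 1F ∷ answer pol w 2F ∷ replicate (length rest) false
mc pol f g _ = []

module _ (pol : Bool) where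

  extremeProg : TM → Prog 𝓢 (Fin 3)
  extremeProg M =
    bind (cmpProg M 0F 1F) λ a →
    bind (cmpProg M (inject₁ (candidate pol a)) 2F) λ b →
    ret (survivor pol (candidate pol a) b)

  emit : Fin 3 → Prog 𝓢 ⊤
  emit w =
    bind (act (push #out (bit (answer pol w 2F)))) λ _ →
    bind (act (push #out (bit (answer pol w 1F)))) λ _ →
    act (push #out (bit (answer pol w 0F)))

  decideProg : TM → TM → Prog 𝓢 ⊤
  decideProg M M′ =
    bind fillers λ _ →
    bind (extremeProg M) λ u →
    bind (extremeProg M′) λ v →
    emit (third u v)

  unless-end : Prog 𝓢 ⊤ → Bool → Prog 𝓢 ⊤
  unless-end p false = ret tt
  unless-end p true  = p

  mcProg : TM → TM → Prog 𝓢 ⊤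
  mcProg M M′ =
    bind (readString 4F) (unless-end (
    bind (readString 5F) (unless-end (
    bind (readString 6F) (unless-end (
    decideProg M M′))))))

-- Running both selectors within one time bound

record Computes (M : TM) (f : Str → Str → Str) (N : ℕ → ℕ) : Set where
  field
    mono : ∀ {m n} → m ≤ n → N m ≤ N n
    runs : ∀ x y → Maybe.map output (exec M (N (length (encodePair (x , y)))) (initial M (encodePair (x , y)))) ≡ just (f x y)

open Computes

stored : (Fin 3 → Str) → Vec (List Elem) 4
stored z = reverse (map bit (z 0F)) ∷ reverse (map bit (z 1F)) ∷ reverse (map bit (z 2F)) ∷ [] ∷ []

lookup-stored : ∀ z i → lookup (stored z) (inject₁ i) ≡ reverse (map bit (z i))
lookup-stored z 0F = refl
lookup-stored z 1F = refl
lookup-stored z 2F = refl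

-- The machine is clocked by the length of the encoded pair, the program by the length `n` of the
-- whole input. `raise` extends the shorter execution, which is where monotonicity of the budget
-- enters.
prefers-run : ∀ {o M f N} → Computes M f N → ∀ z i j {n} →
  length (z i) ≤ n → length (z j) ≤ n → length (encodePair (z i , z j)) ≤ n →
  Run (cmpProg M (inject₁ i) (inject₁ j)) ([] ∷ [] ∷ [] ∷ o ∷ stored z) (prefers f z i j)
      ([] ∷ [] ∷ [] ∷ o ∷ stored z) (cmpTime n (N n))
prefers-run {o} {M} {f} {N} comp z i j {n} i≤ j≤ ij≤ =
  cmp-run M (inject₁ i) (inject₁ j) (stored z) (z i) (z j) (f (z i) (z j))
    (lookup-stored z i) (lookup-stored z j) i≤ j≤ ij≤
    (raise (exec M (N (length (encodePair (z i , z j)))) (initial M (encodePair (z i , z j)))) refl (runs comp (z i) (z j)))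
  where
  raise : ∀ e → exec M (N (length (encodePair (z i , z j)))) (initial M (encodePair (z i , z j))) ≡ e →
    Maybe.map output e ≡ just (f (z i) (z j)) →
    Maybe.map output (exec M (N n) (initial M (encodePair (z i , z j)))) ≡ just (f (z i) (z j))
  raise (just c) ex out = trans (cong (Maybe.map output)
    (exec-mono M {c = initial M (encodePair (z i , z j))} (mono comp ij≤) ex)) out

length-encBits : ∀ w → length w ≤ length (encBits w)
length-encBits []          = z≤n
length-encBits (false ∷ w) = s≤s (m≤n⇒m≤1+n (length-encBits w))
length-encBits (true ∷ w)  = s≤s (m≤n⇒m≤1+n (length-encBits w))

length-encodeList : ∀ z zs → length (encodeList (z ∷ zs)) ≡ length (encBits z) + (2 + length (encodeList zs))
length-encodeList z zs = length-++ (encBits z)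

encode-head : ∀ z zs → length z ≤ length (encodeList (z ∷ zs))
encode-head z zs = ≤-trans (length-encBits z)
  (≤-trans (m≤m+n _ _) (≤-reflexive (sym (length-encodeList z zs))))

encode-tail : ∀ z zs → length (encodeList zs) ≤ length (encodeList (z ∷ zs))
encode-tail z zs = ≤-trans (m≤n+m _ (length (encBits z) + 2))
  (≤-reflexive (trans (+-assoc (length (encBits z)) 2 _) (sym (length-encodeList z zs))))

encode-cons : ∀ z {xs ys} → length (encodeList xs) ≤ length (encodeList ys) →
  length (encodeList (z ∷ xs)) ≤ length (encodeList (z ∷ ys))
encode-cons z {xs} {ys} le = ≤-trans (≤-reflexive (length-encodeList z xs))
  (≤-trans (+-monoʳ-≤ (length (encBits z)) (+-monoʳ-≤ 2 le)) (≤-reflexive (sym (length-encodeList z ys))))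

encode-head₂ : ∀ x y zs → length y ≤ length (encodeList (x ∷ y ∷ zs))
encode-head₂ x y zs = ≤-trans (encode-head y zs) (encode-tail x (y ∷ zs))

encode-head₃ : ∀ x y z zs → length z ≤ length (encodeList (x ∷ y ∷ z ∷ zs))
encode-head₃ x y z zs = ≤-trans (encode-head₂ y z zs) (encode-tail x (y ∷ z ∷ zs))

-- The pairs bounded here are exactly those that `extreme` compares.
record Fits (z : Fin 3 → Str) (n : ℕ) : Set where
  field
    one  : ∀ i → length (z i) ≤ n
    fst₂ : length (encodePair (z 0F , z 1F)) ≤ n
    snd₂ : ∀ b a → length (encodePair (z (candidate b a) , z 2F)) ≤ n

fits : ∀ x y z rest → Fits (triple x y z) (length (encodeList (x ∷ y ∷ z ∷ rest)))
fits x y z rest = record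
  { one = λ { 0F → encode-head x (y ∷ z ∷ rest)
            ; 1F → encode-head₂ x y (z ∷ rest)
            ; 2F → encode-head₃ x y z rest }
  ; fst₂ = encode-cons x {y ∷ []} {y ∷ z ∷ rest} (encode-cons y {[]} {z ∷ rest} z≤n)
  ; snd₂ = λ b a → second (a xor b) }
  where
  second : ∀ c → length (encodePair (triple x y z (if c then 1F else 0F) , z)) ≤ length (encodeList (x ∷ y ∷ z ∷ rest))
  second true  = ≤-trans (encode-cons y {z ∷ []} {z ∷ rest} (encode-cons z {[]} {rest} z≤n)) (encode-tail x (y ∷ z ∷ rest))
  second false = encode-cons x {z ∷ []} {y ∷ z ∷ rest} (≤-trans (encode-cons z {[]} {rest} z≤n) (encode-tail y (z ∷ rest)))

extremeTime : ℕ → ℕ → ℕ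
extremeTime n N = cmpTime n N + (cmpTime n N + 1)

extreme-run : ∀ pol {o M f N} → Computes M f N → ∀ z {n} → Fits z n →
  Run (extremeProg pol M) ([] ∷ [] ∷ [] ∷ o ∷ stored z) (extreme pol (prefers f z))
      ([] ∷ [] ∷ [] ∷ o ∷ stored z) (extremeTime n (N n))
extreme-run pol {f = f} comp z fit =
  bind (prefers-run comp z 0F 1F (one 0F) (one 1F) fst₂)
  (bind (prefers-run comp z (candidate pol (prefers f z 0F 1F)) 2F (one _) (one 2F) (snd₂ pol (prefers f z 0F 1F)))
  ret)
  where open Fits fit

decideTime : ℕ → ℕ → ℕ → ℕ
decideTime n N N′ = 2 + n * 3 + (extremeTime n N + (extremeTime n N′ + 3))

mcTime : ℕ → ℕ → ℕ → ℕ
mcTime n N N′ = 2 + n * 3 + (2 + n * 3 + (2 + n * 3 + decideTime n N N′))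

module _ (pol : Bool) {M M′ f g N N′} (comp : Computes M f N) (comp′ : Computes M′ g N′) where

  decide-run : ∀ x y z rest → let zs = x ∷ y ∷ z ∷ rest ; n = length (encodeList zs) in
    Run (decideProg pol M M′) ([] ∷ [] ∷ [] ∷ [] ∷ reverse (map bit x) ∷ reverse (map bit y) ∷ reverse (map bit z) ∷ letters rest ∷ []) tt
      ([] ∷ [] ∷ [] ∷ map bit (mc pol f g zs) ∷ stored (triple x y z)) (decideTime n (N n) (N′ n))
  decide-run x y z rest =
    bind (slack (+-monoʳ-≤ 2 (*-monoˡ-≤ 3 (≤-trans (length-letters rest)
        (≤-trans (encode-tail z rest) (≤-trans (encode-tail y (z ∷ rest)) (encode-tail x (y ∷ z ∷ rest)))))))
      (fillers-run rest))
    (bind (extreme-run pol comp (triple x y z) (fits x y z rest))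
    (bind (extreme-run pol comp′ (triple x y z) (fits x y z rest))
    (bind (act refl) (bind (act refl) (act refl)))))

  mc-run : ∀ zs → let n = length (encodeList zs) in
    Σ (StackState 7) λ s → Run (mcProg pol M M′) (start zs) tt s (mcTime n (N n) (N′ n)) ×
                           lookup s #out ≡ map bit (mc pol f g zs)
  mc-run [] = _ , bind (readString-end st₁ (λ _ _ → refl) (λ _ _ _ → refl) (λ _ _ _ → refl) []) (slack (s≤s z≤n) ret) , refl
    where
    st₁ : List Elem → List Elem → StackState 7
    st₁ a xs = [] ∷ [] ∷ [] ∷ [] ∷ a ∷ [] ∷ [] ∷ xs ∷ []
  mc-run (x ∷ []) = _ ,
    bind (slack (+-monoʳ-≤ 2 (*-monoˡ-≤ 3 (encode-head x [])))
      (readString-run (λ a xs → [] ∷ [] ∷ [] ∷ [] ∷ a ∷ [] ∷ [] ∷ xs ∷ []) (λ _ _ → refl) (λ _ _ _ → refl) (λ _ _ _ → refl) x [] []))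
    (bind (slack (s≤s (s≤s z≤n)) (readString-end (λ a xs → [] ∷ [] ∷ [] ∷ [] ∷ reverse (map bit x) ∷ a ∷ [] ∷ xs ∷ [])
        (λ _ _ → refl) (λ _ _ _ → refl) (λ _ _ _ → refl) []))
    (slack (s≤s z≤n) ret)) , refl
  mc-run (x ∷ y ∷ []) = _ ,
    bind (slack (+-monoʳ-≤ 2 (*-monoˡ-≤ 3 (encode-head x (y ∷ []))))
      (readString-run (λ a xs → [] ∷ [] ∷ [] ∷ [] ∷ a ∷ [] ∷ [] ∷ xs ∷ []) (λ _ _ → refl) (λ _ _ _ → refl) (λ _ _ _ → refl) x [] (letters (y ∷ []))))
    (bind (slack (+-monoʳ-≤ 2 (*-monoˡ-≤ 3 (encode-head₂ x y [])))
      (readString-run (λ a xs → [] ∷ [] ∷ [] ∷ [] ∷ reverse (map bit x) ∷ a ∷ [] ∷ xs ∷ []) (λ _ _ → refl) (λ _ _ _ → refl) (λ _ _ _ → refl) y [] []))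
    (bind (slack (s≤s (s≤s z≤n)) (readString-end (λ a xs → [] ∷ [] ∷ [] ∷ [] ∷ reverse (map bit x) ∷ reverse (map bit y) ∷ a ∷ xs ∷ [])
        (λ _ _ → refl) (λ _ _ _ → refl) (λ _ _ _ → refl) []))
    (slack (s≤s z≤n) ret))) , refl
  mc-run (x ∷ y ∷ z ∷ rest) = _ ,
    bind (slack (+-monoʳ-≤ 2 (*-monoˡ-≤ 3 (encode-head x (y ∷ z ∷ rest))))
      (readString-run (λ a xs → [] ∷ [] ∷ [] ∷ [] ∷ a ∷ [] ∷ [] ∷ xs ∷ []) (λ _ _ → refl) (λ _ _ _ → refl) (λ _ _ _ → refl) x [] (letters (y ∷ z ∷ rest))))
    (bind (slack (+-monoʳ-≤ 2 (*-monoˡ-≤ 3 (encode-head₂ x y (z ∷ rest))))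
      (readString-run (λ a xs → [] ∷ [] ∷ [] ∷ [] ∷ reverse (map bit x) ∷ a ∷ [] ∷ xs ∷ []) (λ _ _ → refl) (λ _ _ _ → refl) (λ _ _ _ → refl) y [] (letters (z ∷ rest))))
    (bind (slack (+-monoʳ-≤ 2 (*-monoˡ-≤ 3 (encode-head₃ x y z rest)))
      (readString-run (λ a xs → [] ∷ [] ∷ [] ∷ [] ∷ reverse (map bit x) ∷ reverse (map bit y) ∷ a ∷ xs ∷ []) (λ _ _ → refl) (λ _ _ _ → refl) (λ _ _ _ → refl) z [] (letters rest)))
    (decide-run x y z rest))) , refl

cmpTime-poly : ∀ {N} → Poly N → Poly (λ n → cmpTime n (N n))
cmpTime-poly {N} pN = poly-+ eight (poly-+ eight (poly-+ (poly-* (poly-suc pN) (poly-const 5))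
  (poly-+ (linear 2 3 poly-id) (poly-+ (linear 3 4 poly-id) (poly-+ (linear 2 3 m) (poly-+ (linear 2 3 m) (poly-const 1)))))))
  where
  eight : Poly (λ n → 8 * suc n)
  eight = poly-* (poly-const 8) (poly-suc poly-id)
  linear : ∀ a b {f} → Poly f → Poly (λ n → a + f n * b)
  linear a b pf = poly-+ (poly-const a) (poly-* pf (poly-const b))
  m : Poly (λ n → suc (n + N n))
  m = poly-suc (poly-+ poly-id pN)

mcTime-poly : ∀ {N N′} → Poly N → Poly N′ → Poly (λ n → mcTime n (N n) (N′ n))
mcTime-poly pN pN′ = poly-+ read (poly-+ read (poly-+ read (poly-+ read
  (poly-+ (extr pN) (poly-+ (extr pN′) (poly-const 3))))))
  where
  read : Poly (λ n → 2 + n * 3)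
  read = poly-+ (poly-const 2) (poly-* poly-id (poly-const 3))
  extr : ∀ {N} → Poly N → Poly (λ n → extremeTime n (N n))
  extr pN = poly-+ (cmpTime-poly pN) (poly-+ (cmpTime-poly pN) (poly-const 1))

mc-FP : ∀ pol {f g} → FP₂ f → FP₂ g → FPList (mc pol f g)
mc-FP pol {f} {g} (M , c , k , run) (M′ , c′ , k′ , run′) =
  computes (mcProg pol M M′) id (mc pol f g) (mcTime-poly (budget-poly c k) (budget-poly c′ k′))
    (mc-run pol (record { mono = budget-mono c k ; runs = λ x y → run (x , y) })
                (record { mono = budget-mono c′ k′ ; runs = λ x y → run′ (x , y) }))
  where
  budget-poly : ∀ c k → Poly (λ n → c * n ^ k + c)
  budget-poly c k = poly-+ (poly-* (poly-const c) (poly-^ poly-id k)) (poly-const c)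
  budget-mono : ∀ c k {m n} → m ≤ n → c * m ^ k + c ≤ c * n ^ k + c
  budget-mono c k m≤n = +-monoˡ-≤ c (*-monoʳ-≤ c (^-monoˡ-≤ k m≤n))

-- The tournament argument

IsSelector : Lang → (Str → Str → Str) → Set
IsSelector A f = ∀ x y → (f x y ≡ x ⊎ f x y ≡ y) × (A x ⊎ A y → A (f x y))

Edge : Bool → Lang → Str → Str → Set
Edge false A x y = A x → A y
Edge true  A x y = A y → A x

module _ {A : Lang} {f : Str → Str → Str} (sel : IsSelector A f) (z : Fin 3 → Str) where

  private
    win : ∀ i j → prefers f z i j ≡ true → A (z j) → A (z i)
    win i j eq a = subst A (eqStr-sound _ _ eq) (proj₂ (sel (z i) (z j)) (inj₂ a))

    lose : ∀ i j → prefers f z i j ≡ false → A (z i) → A (z j)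
    lose i j eq a with proj₁ (sel (z i) (z j))
    ... | inj₂ fj = subst A fj (proj₂ (sel (z i) (z j)) (inj₁ a))
    ... | inj₁ fi with () ← trans (sym eq) (trans (cong (λ w → eqStr w (z i)) fi) (eqStr-refl (z i)))

  -- Two comparisons suffice: each of them eliminates one vertex, and the answer that eliminates it
  -- is itself the required edge, the other end being its opponent.
  extreme-edge : ∀ pol y → y ≢ extreme pol (prefers f z) → Σ (Fin 3) λ x → x ≢ y × Edge pol A (z x) (z y)
  extreme-edge false y y≢ with prefers f z 0F 1F in e
  ... | true with prefers f z 1F 2F in e′
  extreme-edge false 0F y≢ | true | true = 1F , (λ ()) , win 0F 1F e
  extreme-edge false 1F y≢ | true | true = 2F , (λ ()) , win 1F 2F e′
  extreme-edge false 2F y≢ | true | true = ⊥-elim (y≢ refl)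
  extreme-edge false 0F y≢ | true | false = 1F , (λ ()) , win 0F 1F e
  extreme-edge false 1F y≢ | true | false = ⊥-elim (y≢ refl)
  extreme-edge false 2F y≢ | true | false = 1F , (λ ()) , lose 1F 2F e′
  extreme-edge false y y≢ | false with prefers f z 0F 2F in e′
  extreme-edge false 0F y≢ | false | true = 2F , (λ ()) , win 0F 2F e′
  extreme-edge false 1F y≢ | false | true = 0F , (λ ()) , lose 0F 1F e
  extreme-edge false 2F y≢ | false | true = ⊥-elim (y≢ refl)
  extreme-edge false 0F y≢ | false | false = ⊥-elim (y≢ refl)
  extreme-edge false 1F y≢ | false | false = 0F , (λ ()) , lose 0F 1F e
  extreme-edge false 2F y≢ | false | false = 0F , (λ ()) , lose 0F 2F e′
  extreme-edge true y y≢ with prefers f z 0F 1F in e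
  ... | true with prefers f z 0F 2F in e′
  extreme-edge true 0F y≢ | true | true = ⊥-elim (y≢ refl)
  extreme-edge true 1F y≢ | true | true = 0F , (λ ()) , win 0F 1F e
  extreme-edge true 2F y≢ | true | true = 0F , (λ ()) , win 0F 2F e′
  extreme-edge true 0F y≢ | true | false = 2F , (λ ()) , lose 0F 2F e′
  extreme-edge true 1F y≢ | true | false = 0F , (λ ()) , win 0F 1F e
  extreme-edge true 2F y≢ | true | false = ⊥-elim (y≢ refl)
  extreme-edge true y y≢ | false with prefers f z 1F 2F in e′
  extreme-edge true 0F y≢ | false | true = 1F , (λ ()) , lose 0F 1F e
  extreme-edge true 1F y≢ | false | true = ⊥-elim (y≢ refl)
  extreme-edge true 2F y≢ | false | true = 1F , (λ ()) , win 1F 2F e′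
  extreme-edge true 0F y≢ | false | false = 1F , (λ ()) , lose 0F 1F e
  extreme-edge true 1F y≢ | false | false = 2F , (λ ()) , lose 1F 2F e′
  extreme-edge true 2F y≢ | false | false = ⊥-elim (y≢ refl)

answer-self : ∀ pol y → answer pol y y ≡ pol
answer-self pol y with y Fin.≟ y
... | yes _ = refl
... | no n  = ⊥-elim (n refl)

answer-other : ∀ pol {x y} → x ≢ y → answer pol y x ≡ not pol
answer-other pol {x} {y} x≢y with x Fin.≟ y
... | yes e = ⊥-elim (x≢y e)
... | no _  = refl

module _ (op : Lang → Lang → Lang) (pol : Bool)
         (refute : ∀ {A B} {x x′ y} → Edge pol A x y → Edge pol B x′ y →
           Agrees (op A B) x (not pol) → Agrees (op A B) x′ (not pol) → ¬ Agrees (op A B) y pol) where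

  -- The vertex `y` avoids both extremes and therefore has an edge for each selector. Membership is
  -- never decided: agreement with the answers is carried along these edges until it contradicts
  -- itself at `y` or at a neighbour.
  op⊆mc3 : op ⊙PSel⊆Pmc 3
  op⊆mc3 A B (f , fp , sel) (g , fp′ , sel′) = mc pol f g , mc-FP pol fp fp′ , avoids
    where
    avoids : (zs : List Str) → 3 ≤ length zs →
      (length (mc pol f g zs) ≡ length zs) × ¬ IsCharVec (op A B) zs (mc pol f g zs)
    avoids [] ()
    avoids (_ ∷ []) (s≤s ())
    avoids (_ ∷ _ ∷ []) (s≤s (s≤s ()))
    avoids (z₀ ∷ z₁ ∷ z₂ ∷ rest) _ = cong (3 +_) (length-replicate (length rest)) , λ { (a₀ , a₁ , a₂ , _) →
      let z = triple z₀ z₁ z₂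
          u = extreme pol (prefers f z)
          v = extreme pol (prefers g z)
          y = third u v
          agrees : ∀ i → Agrees (op A B) (z i) (answer pol y i)
          agrees = λ { 0F → a₀ ; 1F → a₁ ; 2F → a₂ }
          (x , x≢ , edge)    = extreme-edge sel z pol y (third≢ˡ u v)
          (x′ , x′≢ , edge′) = extreme-edge sel′ z pol y (third≢ʳ u v)
      in refute {A} {B} edge edge′
           (subst (Agrees (op A B) (z x)) (answer-other pol x≢) (agrees x))
           (subst (Agrees (op A B) (z x′)) (answer-other pol x′≢) (agrees x′))
           (subst (Agrees (op A B) (z y)) (answer-self pol y) (agrees y)) }

∩⊆mc3 : _∩_ ⊙PSel⊆Pmc 3
∩⊆mc3 = op⊆mc3 _∩_ false λ ex ex′ (a , _) (_ , b) n → n (ex a , ex′ b)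

∪⊆mc3 : _∪_ ⊙PSel⊆Pmc 3
∪⊆mc3 = op⊆mc3 _∪_ true λ ex ex′ n n′ → λ { (inj₁ a) → n (inj₁ (ex a)) ; (inj₂ b) → n′ (inj₂ (ex′ b)) }

-- Cuts in a lexicographic order on every other bit

-- The phase is true when the next bit is one of those compared.
decide : Bool → Bool → Bool → Bool ⊎ Bool
decide false a b = inj₁ true
decide true  a b = if same a b then inj₁ false else inj₂ (not a)

precedes : Bool → Str → Str → Bool
precedes ph []      y       = true
precedes ph (a ∷ x) []      = false
precedes ph (a ∷ x) (b ∷ y) = [ (λ ph′ → precedes ph′ x y) , id ]′ (decide ph a b)

least : Bool → Str → Str → Str
least ph x y = if precedes ph x y then x else y

-- A string whose compared bits all agree with the infinite word `r` counts as inside. At the first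
-- disagreement the string is smaller exactly if `r` has a 1 there, hence the value `r 0`.
below : Bool → (ℕ → Bool) → Str → Bool
below ph    r []      = true
below false r (a ∷ x) = below true r x
below true  r (a ∷ x) = if same a (r 0) then below false (r ∘ suc) x else r 0

cut : Bool → (ℕ → Bool) → Lang
cut ph r x = below ph r x ≡ true

-- At a compared position either `x` drops below `r` at once, or both strings agree with `r` and the
-- comparison continues; every other combination contradicts `p` or `c`.
precedes-below : ∀ ph r x y → precedes ph x y ≡ true → cut ph r y → cut ph r x
precedes-below ph    r []          y           p c = refl
precedes-below false r (a ∷ x)     (b ∷ y)     p c = precedes-below true r x y p c
precedes-below true  r (a ∷ x)     (b ∷ y)     p c with r 0
precedes-below true  r (true ∷ x)  (true ∷ y)  p c | true  = precedes-below false (r ∘ suc) x y p c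
precedes-below true  r (false ∷ x) (b ∷ y)     p c | true  = refl
precedes-below true  r (false ∷ x) (false ∷ y) p c | false = precedes-below false (r ∘ suc) x y p c

precedes-above : ∀ ph r x y → precedes ph x y ≡ false → cut ph r x → cut ph r y
precedes-above ph    r (a ∷ x)     []          p c = refl
precedes-above false r (a ∷ x)     (b ∷ y)     p c = precedes-above true r x y p c
precedes-above true  r (a ∷ x)     (b ∷ y)     p c with r 0
precedes-above true  r (true ∷ x)  (true ∷ y)  p c | true  = precedes-above false (r ∘ suc) x y p c
precedes-above true  r (a ∷ x)     (false ∷ y) p c | true  = refl
precedes-above true  r (false ∷ x) (false ∷ y) p c | false = precedes-above false (r ∘ suc) x y p c

least-selects : ∀ ph r → IsSelector (cut ph r) (least ph)
least-selects ph r x y with precedes ph x y in eq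
... | true  = inj₁ refl , λ { (inj₁ c) → c ; (inj₂ c) → precedes-below ph r x y eq c }
... | false = inj₂ refl , λ { (inj₁ c) → precedes-above ph r x y eq c ; (inj₂ c) → c }

-- A stack program for the selector of a cut

value : Elem → Bool
value (_ , just b)  = b
value (_ , nothing) = false

compare : Bool → Prog 𝓢 Bool
compare = iter λ ph → bind (act (pop #tmp)) (first ph)
  where
  second : Bool → Elem → Maybe Elem → Prog 𝓢 (Bool ⊎ Bool)
  second ph e nothing   = ret (inj₂ false)
  second ph e (just e′) = bind (act (push 5F e′)) λ _ → ret (decide ph (value e) (value e′))
  first : Bool → Maybe Elem → Prog 𝓢 (Bool ⊎ Bool)
  first ph nothing  = ret (inj₂ true)
  first ph (just e) = bind (act (push 4F e)) λ _ → bind (act (pop #right)) (second ph e)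

leastProg : Bool → Prog 𝓢 ⊤
leastProg ph =
  bind (readString 4F) λ _ →
  bind (readString 5F) λ _ →
  bind (transfer 4F #tmp) λ _ →
  bind (transfer 5F #right) λ _ →
  bind (compare ph) λ b →
  bind (transfer #tmp 4F) λ _ →
  bind (transfer #right 5F) λ _ →
  transfer (if b then 4F else 5F) #out

board : List Elem → List Elem → List Elem → List Elem → List Elem → List Elem → StackState 7
board t r o p q i = t ∷ [] ∷ r ∷ o ∷ p ∷ q ∷ [] ∷ i ∷ []

-- The comparison may stop in the middle of a string. `joins` says that moving the unread rest back
-- as well restores the whole reversed string.
record Split (x : Str) (p : List Elem) : Set where
  field
    rest    : Str
    shifted : List Elem
    joins   : map bit rest ʳ++ shifted ≡ map bit x ʳ++ p
    shorter : length rest ≤ length x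

open Split

unsplit : ∀ x p → Split x p
unsplit x p = record { rest = x ; shifted = p ; joins = refl ; shorter = ≤-refl }

advance : ∀ a x p → Split x (bit a ∷ p) → Split (a ∷ x) p
advance a x p s = record { rest = rest s ; shifted = shifted s ; joins = joins s ; shorter = m≤n⇒m≤1+n (shorter s) }

compare-run : ∀ ph x y p q → Σ (Split x p) λ s → Σ (Split y q) λ s′ →
  Run (compare ph) (board (map bit x) (map bit y) [] p q []) (precedes ph x y)
      (board (map bit (rest s)) (map bit (rest s′)) [] (shifted s) (shifted s′) []) (4 + length x * 5)
compare-run ph [] y p q = unsplit [] p , unsplit y q ,
  slack (s≤s (s≤s z≤n)) (done (bind (act refl) ret))
compare-run ph (a ∷ x) [] p q = advance a x p (unsplit x (bit a ∷ p)) , unsplit [] q ,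
  slack (m≤m+n 4 _) (done (bind (act refl) (bind (act refl) (bind (act refl) ret))))
compare-run ph (a ∷ x) (b ∷ y) p q with decide ph a b in eq
... | inj₂ c = advance a x p (unsplit x (bit a ∷ p)) , advance b y q (unsplit y (bit b ∷ q)) ,
  slack (≤-trans (m≤m+n 5 (length x * 5)) (m≤n+m _ 4))
    (done (bind (act refl) (bind (act refl) (bind (act refl) (bind (act refl)
      (subst (λ o → Run (ret {𝓢} o) final (inj₂ c) final 1) (sym eq) ret))))))
  where final = board (map bit x) (map bit y) [] (bit a ∷ p) (bit b ∷ q) []
... | inj₁ ph′ = let (s , s′ , π) = compare-run ph′ x y (bit a ∷ p) (bit b ∷ q) in
  advance a x p s , advance b y q s′ ,
  slack (≤-reflexive (trans (sym (+-assoc 5 4 _)) (trans (cong (_+ length x * 5) (+-comm 5 4)) (+-assoc 4 5 _))))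
    (again (bind (act refl) (bind (act refl) (bind (act refl) (bind (act refl)
      (subst (λ o → Run (ret {𝓢} o) mid (inj₁ ph′) mid 1) (sym eq) ret))))) π)
  where mid = board (map bit x) (map bit y) [] (bit a ∷ p) (bit b ∷ q) []

leastTime : ℕ → ℕ
leastTime n = let m = 2 + n * 3 in m + (m + (m + (m + (4 + n * 5 + (m + (m + m))))))

leastTime-poly : Poly leastTime
leastTime-poly = poly-+ m (poly-+ m (poly-+ m (poly-+ m (poly-+
  (poly-+ (poly-const 4) (poly-* poly-id (poly-const 5))) (poly-+ m (poly-+ m m))))))
  where
  m : Poly (λ n → 2 + n * 3)
  m = poly-+ (poly-const 2) (poly-* poly-id (poly-const 3))

reverse-twice : ∀ (xs : List Elem) → reverse xs ʳ++ [] ≡ xs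
reverse-twice xs = trans (ʳ++-ʳ++ xs) (++-identityʳ xs)

length-reverse-bits : ∀ x → length (reverse (map bit x)) ≡ length x
length-reverse-bits x = trans (trans (length-ʳ++ (map bit x)) (+-identityʳ _)) (length-map bit x)

emit-run : ∀ b x y n → length x ≤ n → length y ≤ n → Σ (StackState 7) λ s →
  Run (transfer (if b then 4F else 5F) #out) (board [] [] [] (reverse (map bit x)) (reverse (map bit y)) []) tt s (2 + n * 3) ×
  lookup s #out ≡ map bit (if b then x else y)
emit-run true x y n x≤ y≤ = _ ,
  slack (+-monoʳ-≤ 2 (*-monoˡ-≤ 3 (≤-trans (≤-reflexive (length-reverse-bits x)) x≤)))
    (transfer-run (λ o xs → board [] [] o xs (reverse (map bit y)) []) (λ _ _ → refl) (λ _ _ _ → refl) (λ _ _ _ → refl) (reverse (map bit x)) []) ,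
  reverse-twice (map bit x)
emit-run false x y n x≤ y≤ = _ ,
  slack (+-monoʳ-≤ 2 (*-monoˡ-≤ 3 (≤-trans (≤-reflexive (length-reverse-bits y)) y≤)))
    (transfer-run (λ o xs → board [] [] o (reverse (map bit x)) xs []) (λ _ _ → refl) (λ _ _ _ → refl) (λ _ _ _ → refl) (reverse (map bit y)) []) ,
  reverse-twice (map bit y)

linear : ∀ {m n} → m ≤ n → 2 + m * 3 ≤ 2 + n * 3
linear m≤n = +-monoʳ-≤ 2 (*-monoˡ-≤ 3 m≤n)

least-run : ∀ ph x y → Σ (StackState 7) λ s →
  Run (leastProg ph) (start (x ∷ y ∷ [])) tt s (leastTime (length (encodePair (x , y)))) ×
  lookup s #out ≡ map bit (least ph x y)
least-run ph x y =
  let (s , s′ , π)   = compare-run ph x y [] []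
      (u , π′ , out) = emit-run (precedes ph x y) x y n x≤ y≤
  in u ,
    bind (slack (linear x≤) (readString-run (λ a xs → board [] [] [] a [] xs) (λ _ _ → refl) (λ _ _ _ → refl) (λ _ _ _ → refl) x [] (letters (y ∷ []))))
    (bind (slack (linear y≤) (readString-run (λ a xs → board [] [] [] (reverse (map bit x)) a xs) (λ _ _ → refl) (λ _ _ _ → refl) (λ _ _ _ → refl) y [] []))
    (bind (slack (linear (≤-trans (≤-reflexive (length-reverse-bits x)) x≤))
      (subst (λ t → Run (transfer 4F #tmp) (board [] [] [] (reverse (map bit x)) (reverse (map bit y)) []) tt (board t [] [] [] (reverse (map bit y)) []) (2 + length (reverse (map bit x)) * 3))
        (reverse-twice (map bit x))
        (transfer-run (λ a xs → board a [] [] xs (reverse (map bit y)) []) (λ _ _ → refl) (λ _ _ _ → refl) (λ _ _ _ → refl) (reverse (map bit x)) [])))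
    (bind (slack (linear (≤-trans (≤-reflexive (length-reverse-bits y)) y≤))
      (subst (λ t → Run (transfer 5F #right) (board (map bit x) [] [] [] (reverse (map bit y)) []) tt (board (map bit x) t [] [] [] []) (2 + length (reverse (map bit y)) * 3))
        (reverse-twice (map bit y))
        (transfer-run (λ a xs → board (map bit x) a [] [] xs []) (λ _ _ → refl) (λ _ _ _ → refl) (λ _ _ _ → refl) (reverse (map bit y)) [])))
    (bind (slack (+-monoʳ-≤ 4 (*-monoˡ-≤ 5 x≤)) π)
    (bind (slack (linear (≤-trans (≤-reflexive (length-map bit (rest s))) (≤-trans (shorter s) x≤)))
      (subst (λ t → Run (transfer #tmp 4F) (board (map bit (rest s)) (map bit (rest s′)) [] (shifted s) (shifted s′) []) tt (board [] (map bit (rest s′)) [] t (shifted s′) []) (2 + length (map bit (rest s)) * 3))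
        (joins s)
        (transfer-run (λ a xs → board xs (map bit (rest s′)) [] a (shifted s′) []) (λ _ _ → refl) (λ _ _ _ → refl) (λ _ _ _ → refl) (map bit (rest s)) (shifted s))))
    (bind (slack (linear (≤-trans (≤-reflexive (length-map bit (rest s′))) (≤-trans (shorter s′) y≤)))
      (subst (λ t → Run (transfer #right 5F) (board [] (map bit (rest s′)) [] (reverse (map bit x)) (shifted s′) []) tt (board [] [] [] (reverse (map bit x)) t []) (2 + length (map bit (rest s′)) * 3))
        (joins s′)
        (transfer-run (λ a xs → board [] xs [] (reverse (map bit x)) a []) (λ _ _ → refl) (λ _ _ _ → refl) (λ _ _ _ → refl) (map bit (rest s′)) (shifted s′))))
    π′)))))) , out
  where
  n = length (encodePair (x , y))
  x≤ : length x ≤ n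
  x≤ = encode-head x (y ∷ [])
  y≤ : length y ≤ n
  y≤ = encode-head₂ x y []

-- The program depends on the phase but not on `r`, so the claim holds for every sequence, in
-- particular for one produced by diagonalisation.
cut-PSel : ∀ ph r → PSel (cut ph r)
cut-PSel ph r = least ph ,
  computes (leastProg ph) (λ { (x , y) → x ∷ y ∷ [] }) (λ { (x , y) → least ph x y }) leastTime-poly
    (λ { (x , y) → least-run ph x y }) ,
  least-selects ph r

-- Enumerating clocked machines

record Enumerable (X : Set) : Set where
  field
    nth-of : ℕ → X
    index  : ∀ x → Σ ℕ λ i → nth-of i ≡ x

open Enumerable

finite-enumerable : {X : Set} → Finite X → X → Enumerable X
finite-enumerable {X} fX x₀ = record { nth-of = at ; index = λ x → toℕ (enc fX x) , at-toℕ x }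
  where
  at : ℕ → X
  at i with i <? card fX
  ... | yes i<n = dec fX (fromℕ< i<n)
  ... | no _    = x₀
  at-toℕ : ∀ x → at (toℕ (enc fX x)) ≡ x
  at-toℕ x with toℕ (enc fX x) <? card fX
  ... | yes i<n = trans (cong (dec fX) (Fin.fromℕ<-toℕ (enc fX x) i<n)) (dec-enc fX x)
  ... | no i≮n  = ⊥-elim (i≮n (Fin.toℕ<n (enc fX x)))

along : ℕ × ℕ → ℕ × ℕ
along (zero  , b) = suc b , 0
along (suc a , b) = a , suc b

diagonal : ℕ → ℕ × ℕ
diagonal zero    = 0 , 0
diagonal (suc i) = along (diagonal i)

-- Walk backwards: within an antidiagonal `b` decreases, and from its first point `(suc a , 0)` one
-- returns to the last point `(0 , a)` of the previous one.
diagonal-onto : ∀ a b → Σ ℕ λ i → diagonal i ≡ (a , b)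
diagonal-onto a b = go (a + b) a b refl
  where
  next-of : ∀ {p} → Σ ℕ (λ i → diagonal i ≡ p) → Σ ℕ λ i → diagonal i ≡ along p
  next-of (i , e) = suc i , cong along e
  go : ∀ s a b → a + b ≡ s → Σ ℕ λ i → diagonal i ≡ (a , b)
  go zero    zero    zero    e = 0 , refl
  go (suc s) (suc a) zero    e = next-of (go s zero a (trans (sym (+-identityʳ a)) (suc-injective e)))
  go s       a       (suc b) e = next-of (go s (suc a) b (trans (sym (+-suc a b)) e))

Σ-enumerable : {P : ℕ → Set} → (∀ n → Enumerable (P n)) → Enumerable (Σ ℕ P)
Σ-enumerable {P} eP = record { nth-of = at ; index = λ { (n , p) → find n p } }
  where
  at : ℕ → Σ ℕ P
  at i = let (n , j) = diagonal i in n , nth-of (eP n) j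
  find : ∀ n p → Σ ℕ λ i → at i ≡ (n , p)
  find n p with index (eP n) p
  ... | j , e with diagonal-onto n j
  ...   | i , d = i , trans (cong (λ { (n , j) → n , nth-of (eP n) j }) d) (cong (n ,_) e)

Move-finite : Finite Move
Move-finite = retract-finite {Y = Maybe Bool}
  (λ { L → nothing ; R → just false ; S → just true })
  (λ { nothing → L ; (just false) → R ; (just true) → S })
  (λ { L → refl ; R → refl ; S → refl }) Maybe-finite

Vec-finite : {X : Set} → Finite X → ∀ n → Finite (Vec X n)
Vec-finite fX zero    = retract-finite {Y = ⊤} (λ _ → tt) (λ _ → []) (λ { [] → refl }) ⊤-finite
Vec-finite fX (suc n) = retract-finite (λ { (x ∷ xs) → x , xs }) (λ { (x , xs) → x ∷ xs })
  (λ { (_ ∷ _) → refl }) (×-finite {{fX}} {{Vec-finite fX n}})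

Table : ℕ → Set
Table n = Fin n × Vec (Vec (Maybe (Fin n × Sym × Move)) 3) n

Table-finite : ∀ n → Finite (Table n)
Table-finite n = ×-finite {{Fin-finite}} {{Vec-finite (Vec-finite
  (Maybe-finite {{×-finite {{Fin-finite}} {{×-finite {{Maybe-finite}} {{Move-finite}}}}}}) 3) n}}

symIndex : Sym → Fin 3
symIndex nothing      = 0F
symIndex (just false) = 1F
symIndex (just true)  = 2F

symAt : Fin 3 → Sym
symAt 0F = nothing
symAt 1F = just false
symAt 2F = just true

symAt-index : ∀ s → symAt (symIndex s) ≡ s
symAt-index nothing      = refl
symAt-index (just false) = refl
symAt-index (just true)  = refl

machine : ∀ {n} → Table n → TM
machine {n} (q , δ) = record { nQ = n ; start = q ; δ = λ q s → lookup (lookup δ q) (symIndex s) }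

-- A machine has a start state, hence n + 1 states.
Clocked : Set
Clocked = Σ ℕ λ n → Σ ℕ λ c → Σ ℕ λ k → Table (suc n)

Clocked-enumerable : Enumerable Clocked
Clocked-enumerable = Σ-enumerable λ n → Σ-enumerable λ _ → Σ-enumerable λ _ →
  finite-enumerable (Table-finite (suc n)) (zero , Vec.replicate _ (Vec.replicate _ nothing))

budget : ℕ → ℕ → Str → ℕ
budget c k w = c * length w ^ k + c

respond-to : Clocked → Str → Maybe Str
respond-to (n , c , k , t) w = Maybe.map output (exec (machine t) (budget c k w) (initial (machine t) w))

module _ {n : ℕ} {q : Fin n} {d d′ : Fin n → Sym → Maybe (Fin n × Sym × Move)} (d≗ : ∀ q s → d q s ≡ d′ q s) where

  private
    M M′ : TM
    M  = record { nQ = n ; start = q ; δ = d }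
    M′ = record { nQ = n ; start = q ; δ = d′ }

  step-cong : ∀ c → step M c ≡ step M′ c
  step-cong (cfg p l h r) with d p h | d′ p h | d≗ p h
  ... | nothing | _ | refl = refl
  ... | just _  | _ | refl = refl

  exec-cong : ∀ m c → exec M m c ≡ exec M′ m c
  exec-cong m c with step M c | step M′ c | step-cong c
  exec-cong m       c | nothing | _ | refl = refl
  exec-cong zero    c | just _  | _ | refl = refl
  exec-cong (suc m) c | just c′ | _ | refl = exec-cong m c′

-- The transition function of a `TM` is an Agda function, recovered from its table only pointwise;
-- `exec-cong` shows that executions respect pointwise equality.
tabled : ∀ M c k → Σ Clocked λ t → ∀ w →
  Maybe.map output (exec M (budget c k w) (initial M w)) ≡ respond-to t w
tabled record { nQ = suc n ; start = q ; δ = δ } c k =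
  (n , c , k , t) , λ w → cong (Maybe.map output) (exec-cong {q = q} same-δ (budget c k w) (initial (machine t) w))
  where
  t : Table (suc n)
  t = q , tabulate (λ q → tabulate (λ i → δ q (symAt i)))
  same-δ : ∀ q s → δ q s ≡ lookup (lookup (proj₂ t) q) (symIndex s)
  same-δ q s = sym (trans (cong (λ v → lookup v (symIndex s)) (lookup∘tabulate (λ q → tabulate (λ i → δ q (symAt i))) q))
    (trans (lookup∘tabulate (λ i → δ q (symAt i)) (symIndex s)) (cong (δ q) (symAt-index s))))

-- Diagonalisation

-- The two bits that one stage adds to each of the two cuts.
Block : Set
Block = (Bool × Bool) × (Bool × Bool)

block : Block → Str
block ((a , a′) , (b , b′)) = a ∷ b ∷ a′ ∷ b′ ∷ []

bits : (ℕ → Bool × Bool) → ℕ → Bool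
bits g zero          = proj₁ (g 0)
bits g (suc zero)    = proj₂ (g 0)
bits g (suc (suc n)) = bits (g ∘ suc) n

≤ᴬ : (ℕ → Block) → Str → Bool
≤ᴬ Γ = below true (bits (proj₁ ∘ Γ))

≤ᴮ : (ℕ → Block) → Str → Bool
≤ᴮ Γ = below false (bits (proj₂ ∘ Γ))

same-refl : ∀ a → same a a ≡ true
same-refl true  = refl
same-refl false = refl

≤ᴬ-block : ∀ Γ x → ≤ᴬ Γ (block (Γ 0) ++ x) ≡ ≤ᴬ (Γ ∘ suc) x
≤ᴬ-block Γ x with Γ 0
... | (a , a′) , _ rewrite same-refl a | same-refl a′ = refl

≤ᴮ-block : ∀ Γ x → ≤ᴮ Γ (block (Γ 0) ++ x) ≡ ≤ᴮ (Γ ∘ suc) x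
≤ᴮ-block Γ x with Γ 0
... | _ , (b , b′) rewrite same-refl b | same-refl b′ = refl

prefix : (ℕ → Block) → ℕ → Str
prefix Γ zero    = []
prefix Γ (suc e) = block (Γ 0) ++ prefix (Γ ∘ suc) e

prefix-snoc : ∀ Γ e → prefix Γ (suc e) ≡ prefix Γ e ++ block (Γ e)
prefix-snoc Γ zero    = ++-identityʳ _
prefix-snoc Γ (suc e) = trans (cong (block (Γ 0) ++_) (prefix-snoc (Γ ∘ suc) e)) (sym (++-assoc (block (Γ 0)) (prefix (Γ ∘ suc) e) (block (Γ (suc e)))))

-- A prefix made of blocks of `Γ` ties with the cut everywhere, so the decision is left to the
-- remaining bits and the remaining blocks.
≤ᴬ-prefix : ∀ Γ e x → ≤ᴬ Γ (prefix Γ e ++ x) ≡ ≤ᴬ (λ i → Γ (e + i)) x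
≤ᴬ-prefix Γ zero    x = refl
≤ᴬ-prefix Γ (suc e) x = trans (cong (≤ᴬ Γ) (++-assoc (block (Γ 0)) (prefix (Γ ∘ suc) e) x))
  (trans (≤ᴬ-block Γ (prefix (Γ ∘ suc) e ++ x)) (≤ᴬ-prefix (Γ ∘ suc) e x))

≤ᴮ-prefix : ∀ Γ e x → ≤ᴮ Γ (prefix Γ e ++ x) ≡ ≤ᴮ (λ i → Γ (e + i)) x
≤ᴮ-prefix Γ zero    x = refl
≤ᴮ-prefix Γ (suc e) x = trans (cong (≤ᴮ Γ) (++-assoc (block (Γ 0)) (prefix (Γ ∘ suc) e) x))
  (trans (≤ᴮ-block Γ (prefix (Γ ∘ suc) e ++ x)) (≤ᴮ-prefix (Γ ∘ suc) e x))

module Diagonal (E : Enumerable Clocked) (tests : List Block) (choose : List Bool → Block) where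

  queries : Str → List Str
  queries w = map (λ t → w ++ block t) tests

  -- A machine that overruns its clock is treated as if it had output `[]`; the block chosen then is
  -- arbitrary.
  stage : ℕ → Str → Block
  stage e w = choose (Maybe.fromMaybe [] (respond-to (nth-of E e) (encodeList (queries w))))

  history : ℕ → Str
  history zero    = []
  history (suc e) = history e ++ block (stage e (history e))

  Γ : ℕ → Block
  Γ e = stage e (history e)

  history-prefix : ∀ e → history e ≡ prefix Γ e
  history-prefix zero    = refl
  history-prefix (suc e) = trans (cong (_++ block (Γ e)) (history-prefix e)) (sym (prefix-snoc Γ e))

  module _ (op : Lang → Lang → Lang) (opᵇ : Bool → Bool → Bool)
           (op-agrees : ∀ (p q : Str → Bool) x → Agrees (op (λ x → p x ≡ true) (λ x → q x ≡ true)) x (opᵇ (p x) (q x)))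
           (chosen : ∀ bs → length bs ≡ length tests →
             map (λ t → opᵇ (≤ᴬ (λ _ → choose bs) (block t)) (≤ᴮ (λ _ → choose bs) (block t))) tests ≡ bs)
           where

    private
      A B : Lang
      A = cut true (bits (proj₁ ∘ Γ))
      B = cut false (bits (proj₂ ∘ Γ))

      charVec : ∀ w ts → IsCharVec (op A B) (map (λ t → w ++ block t) ts)
                           (map (λ t → opᵇ (≤ᴬ Γ (w ++ block t)) (≤ᴮ Γ (w ++ block t))) ts)
      charVec w []       = tt
      charVec w (t ∷ ts) = op-agrees (≤ᴬ Γ) (≤ᴮ Γ) (w ++ block t) , charVec w ts

      local : ∀ e t → opᵇ (≤ᴬ Γ (history e ++ block t)) (≤ᴮ Γ (history e ++ block t)) ≡
                      opᵇ (≤ᴬ (λ _ → Γ e) (block t)) (≤ᴮ (λ _ → Γ e) (block t))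
      local e t = cong₂ opᵇ
        (trans (cong (λ w → ≤ᴬ Γ (w ++ block t)) (history-prefix e))
          -- `block t` ends after four bits, so `below` reads only the first block of the shifted
          -- sequence. By computation the sequence may thus be taken constant, and only `e + 0`
          -- remains to be simplified.
          (trans (≤ᴬ-prefix Γ e (block t)) (cong (λ i → ≤ᴬ (λ _ → Γ i) (block t)) (+-identityʳ e))))
        (trans (cong (λ w → ≤ᴮ Γ (w ++ block t)) (history-prefix e))
          (trans (≤ᴮ-prefix Γ e (block t)) (cong (λ i → ≤ᴮ (λ _ → Γ i) (block t)) (+-identityʳ e))))

      outcome : Block → List Bool
      outcome γ = map (λ t → opᵇ (≤ᴬ (λ _ → γ) (block t)) (≤ᴮ (λ _ → γ) (block t))) tests

    -- At the stage `e` of the machine for `f`, the block `Γ e` is `choose (f zs)`. By `chosen` the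
    -- tests then have exactly the answers `f zs`, which is the vector that `f` claims to avoid.
    ∉Pmc : ∀ k → k ≤ length tests → ¬ Pmc k (op A B)
    ∉Pmc k k≤ (f , (M , c , d , run) , avoid) =
      let (t , t≡)   = tabled M c d
          (e , e≡)   = index E t
          zs         = queries (history e)
          zs-length  = length-map (λ t → history e ++ block t) tests
          (len , ¬χ) = avoid zs (≤-trans k≤ (≤-reflexive (sym zs-length)))
          Γ≡ : Γ e ≡ choose (f zs)
          Γ≡ = cong (λ r → choose (Maybe.fromMaybe [] r))
                 (trans (cong (λ t → respond-to t (encodeList zs)) e≡) (trans (sym (t≡ (encodeList zs))) (run zs)))
      in ¬χ (subst (IsCharVec (op A B) zs)
           (trans (map-cong (local e) tests) (trans (cong outcome Γ≡) (chosen (f zs) (trans len zs-length))))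
           (charVec (history e) tests))

    escapes : ∀ k → k ≤ length tests → op ⊙PSel⊈Pmc k
    escapes k k≤ = A , B , cut-PSel true (bits (proj₁ ∘ Γ)) , cut-PSel false (bits (proj₂ ∘ Γ)) , ∉Pmc k k≤

-- Tests and choices for the four operations

absurd : ∀ {X : Set} {b : Bool} → b ≡ true → b ≡ false → X
absurd refl ()

-- A test is inside a cut if and only if its two-bit value is at most the chosen one. The least
-- value is always inside, so tests use only 1, 2 and 3, and choosing 0 excludes them all; two bits
-- are the fewest that offer three such values.
pattern 0₂ = false , false
pattern 1₂ = false , true
pattern 2₂ = true , false
pattern 3₂ = true , true

-- The first two tests are ordered oppositely by the two cuts.
t₁ t₂ t₃ : Block
t₁ = 1₂ , 2₂
t₂ = 2₂ , 1₂
t₃ = 3₂ , 3₂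

-- The traces on the tests are the empty set, `t₁`, `t₁ t₂`, all for the first cut and the empty
-- set, `t₂`, `t₁ t₂`, all for the second. Their symmetric differences yield all eight subsets; for
-- instance `t₁ t₃` is all against `t₂`, whence `3₂ , 1₂`. The last clause of each table also
-- catches lists of the wrong length.
∩-choice ∪-choice xor-choice nxor-choice : List Bool → Block
∩-choice (false ∷ false ∷ _) = 0₂ , 0₂
∩-choice (true ∷ false ∷ _)  = 1₂ , 2₂
∩-choice (false ∷ true ∷ _)  = 2₂ , 1₂
∩-choice _                   = 2₂ , 2₂

∪-choice (false ∷ false ∷ _) = 0₂ , 0₂
∪-choice (true ∷ false ∷ _)  = 1₂ , 0₂
∪-choice (false ∷ true ∷ _)  = 0₂ , 1₂
∪-choice _                   = 2₂ , 0₂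

xor-choice (false ∷ false ∷ true ∷ _)  = 2₂ , 3₂
xor-choice (false ∷ true ∷ false ∷ _)  = 0₂ , 1₂
xor-choice (false ∷ true ∷ true ∷ _)   = 1₂ , 3₂
xor-choice (true ∷ false ∷ false ∷ _)  = 1₂ , 0₂
xor-choice (true ∷ false ∷ true ∷ _)   = 3₂ , 1₂
xor-choice (true ∷ true ∷ false ∷ _)   = 0₂ , 2₂
xor-choice (true ∷ true ∷ true ∷ _)    = 0₂ , 3₂
xor-choice _                           = 0₂ , 0₂

nxor-choice bs = xor-choice (map not bs)

∩⊈mc2 : _∩_ ⊙PSel⊈Pmc 2
∩⊈mc2 = Diagonal.escapes Clocked-enumerable (t₁ ∷ t₂ ∷ []) ∩-choice _∩_ _∧_ agrees chosen 2 ≤-refl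
  where
  agrees : ∀ (p q : Str → Bool) x → Agrees ((λ x → p x ≡ true) ∩ (λ x → q x ≡ true)) x (p x ∧ q x)
  agrees p q x with p x in ep | q x in eq
  ... | true  | true  = ep , eq
  ... | true  | false = λ { (_ , b) → absurd b eq }
  ... | false | _     = λ { (a , _) → absurd a ep }
  chosen : ∀ bs → length bs ≡ 2 → _ ≡ bs
  chosen (false ∷ false ∷ []) _ = refl
  chosen (false ∷ true ∷ [])  _ = refl
  chosen (true ∷ false ∷ [])  _ = refl
  chosen (true ∷ true ∷ [])   _ = refl

∪⊈mc2 : _∪_ ⊙PSel⊈Pmc 2
∪⊈mc2 = Diagonal.escapes Clocked-enumerable (t₁ ∷ t₂ ∷ []) ∪-choice _∪_ _∨_ agrees chosen 2 ≤-refl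
  where
  agrees : ∀ (p q : Str → Bool) x → Agrees ((λ x → p x ≡ true) ∪ (λ x → q x ≡ true)) x (p x ∨ q x)
  agrees p q x with p x in ep | q x in eq
  ... | true  | _     = inj₁ ep
  ... | false | true  = inj₂ eq
  ... | false | false = λ { (inj₁ a) → absurd a ep ; (inj₂ b) → absurd b eq }
  chosen : ∀ bs → length bs ≡ 2 → _ ≡ bs
  chosen (false ∷ false ∷ []) _ = refl
  chosen (false ∷ true ∷ [])  _ = refl
  chosen (true ∷ false ∷ [])  _ = refl
  chosen (true ∷ true ∷ [])   _ = refl

xor⊈mc3 : _XOR_ ⊙PSel⊈Pmc 3
xor⊈mc3 = Diagonal.escapes Clocked-enumerable (t₁ ∷ t₂ ∷ t₃ ∷ []) xor-choice _XOR_ _xor_ agrees chosen 3 ≤-refl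
  where
  agrees : ∀ (p q : Str → Bool) x → Agrees ((λ x → p x ≡ true) XOR (λ x → q x ≡ true)) x (p x xor q x)
  agrees p q x with p x in ep | q x in eq
  ... | true  | true  = λ { (inj₁ (_ , ¬b)) → ¬b eq ; (inj₂ (¬a , _)) → ¬a ep }
  ... | true  | false = inj₁ (ep , λ b → absurd b eq)
  ... | false | true  = inj₂ ((λ a → absurd a ep) , eq)
  ... | false | false = λ { (inj₁ (a , _)) → absurd a ep ; (inj₂ (_ , b)) → absurd b eq }
  chosen : ∀ bs → length bs ≡ 3 → _ ≡ bs
  chosen (false ∷ false ∷ false ∷ []) _ = refl
  chosen (false ∷ false ∷ true ∷ [])  _ = refl
  chosen (false ∷ true ∷ false ∷ [])  _ = refl
  chosen (false ∷ true ∷ true ∷ [])   _ = refl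
  chosen (true ∷ false ∷ false ∷ [])  _ = refl
  chosen (true ∷ false ∷ true ∷ [])   _ = refl
  chosen (true ∷ true ∷ false ∷ [])   _ = refl
  chosen (true ∷ true ∷ true ∷ [])    _ = refl

nxor⊈mc3 : _NXOR_ ⊙PSel⊈Pmc 3
nxor⊈mc3 = Diagonal.escapes Clocked-enumerable (t₁ ∷ t₂ ∷ t₃ ∷ []) nxor-choice _NXOR_ (λ a b → not (a xor b)) agrees chosen 3 ≤-refl
  where
  agrees : ∀ (p q : Str → Bool) x → Agrees ((λ x → p x ≡ true) NXOR (λ x → q x ≡ true)) x (not (p x xor q x))
  agrees p q x with p x in ep | q x in eq
  ... | true  | true  = inj₁ (ep , eq)
  ... | true  | false = λ { (inj₁ (_ , b)) → absurd b eq ; (inj₂ (¬a , _)) → ¬a ep }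
  ... | false | true  = λ { (inj₁ (a , _)) → absurd a ep ; (inj₂ (_ , ¬b)) → ¬b eq }
  ... | false | false = inj₂ ((λ a → absurd a ep) , λ b → absurd b eq)
  chosen : ∀ bs → length bs ≡ 3 → _ ≡ bs
  chosen (false ∷ false ∷ false ∷ []) _ = refl
  chosen (false ∷ false ∷ true ∷ [])  _ = refl
  chosen (false ∷ true ∷ false ∷ [])  _ = refl
  chosen (false ∷ true ∷ true ∷ [])   _ = refl
  chosen (true ∷ false ∷ false ∷ [])  _ = refl
  chosen (true ∷ false ∷ true ∷ [])   _ = refl
  chosen (true ∷ true ∷ false ∷ [])   _ = refl
  chosen (true ∷ true ∷ true ∷ [])    _ = refl

theorem4p7 : ((_∩_ ⊙PSel⊆Pmc 3) × (_∩_ ⊙PSel⊈Pmc 2))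
    × ((_∪_ ⊙PSel⊆Pmc 3) × (_∪_ ⊙PSel⊈Pmc 2))
    × ((_XOR_ ⊙PSel⊈Pmc 3) × (_NXOR_ ⊙PSel⊈Pmc 3))
theorem4p7 = (∩⊆mc3 , ∩⊈mc2) , (∪⊆mc3 , ∪⊈mc2) , (xor⊈mc3 , nxor⊈mc3)
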